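{- Let $k\ge 1$ and $n$ be integers, let $\mathcal{F}\subseteq \binom{[n]}{k}$, and assume that $n\ge (k^3+2k^2+k)/2$. Then \[ \Phi_{n,k}(\mathcal{F})=\sum_{A\in \mathcal{F}}\frac{1}{\binom{n-i_{\mathcal{F}}(A)}{k-i_{\mathcal{F}}(A)}}\le 1. \] Moreover, equality holds if and only if $\mathcal{F}$ is a $c$-star for some $0\le c\le k$.
   Context: $\binom{[n]}{k}$ denotes the family of all $k$-element subsets of $[n]=\{1,\dots,n\}$. For $\mathcal{F}\subseteq\binom{[n]}{k}$ and $A\in\mathcal{F}$, $i_{\mathcal{F}}(A):=\min_{B\in\mathcal{F}}|A\cap B|$. A $c$-star is the family of all $k$-subsets of $[n]$ containing a fixed $c$-element set. -}

module Defs where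

open import Data.Nat using (ℕ; zero; suc; _⊓_; _∸_)
open import Data.Nat.Combinatorics using (_C_)
open import Data.Integer using (+_)
open import Data.Fin.Subset using (Subset; ∣_∣; _∩_; _⊆_)
open import Data.List using (List; []; _∷_; foldr)
open import Data.List.Membership.Propositional using (_∈_)
open import Data.Rational using (ℚ; _/_; _+_; 0ℚ)
open import Data.Product using (Σ; _×_)
open import Relation.Binary.PropositionalEquality using (_≡_)
open import Function.Bundles using (_⇔_)

-- A family of subsets of [n] is represented by a list of subsets
-- (duplicate-freeness is imposed separately in the statement).
Family : ℕ → Set
Family n = List (Subset n)

-- min over B in the list of |A ∩ B|, with initial value |A|
-- (correct for A ∈ F since |A ∩ A| = |A| and |A ∩ B| ≤ |A|).
minInter : ∀ {n} → Subset n → Family n → ℕ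
minInter A [] = ∣ A ∣
minInter A (B ∷ Bs) = ∣ A ∩ B ∣ ⊓ minInter A Bs

iF : ∀ {n} → Family n → Subset n → ℕ
iF F A = minInter A F

-- reciprocal 1/m of a natural number (m = 0 never occurs in the theorem;
-- it is sent to 0 only to make the function total)
recip : ℕ → ℚ
recip zero = 0ℚ
recip (suc m) = + 1 / suc m

Φ : (n k : ℕ) → Family n → ℚ
Φ n k F = foldr (λ A acc → recip ((n ∸ iF F A) C (k ∸ iF F A)) + acc) 0ℚ F

AllOfSize : ∀ {n} → ℕ → Family n → Set
AllOfSize {n} k F = ∀ A → A ∈ F → ∣ A ∣ ≡ k

IsStar : ∀ {n} → ℕ → ℕ → Family n → Set
IsStar {n} k c F = Σ (Subset n) λ S → ∣ S ∣ ≡ c × (∀ A → (A ∈ F ⇔ (∣ A ∣ ≡ k × S ⊆ A)))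

{-# OPTIONS --safe #-}
module Submission where

{-
Label every set of the family with its level i(A), and let the weights depend on the labels only;
all that is needed is |A ∩ B| ≥ i(A) for members A and B. A left shift moves the larger of the two
labels of A and of its shift to the left, which keeps both this condition and the total weight, so
the labelling may be assumed shifted.

For a shifted labelling split by the first point. Two members avoiding it and meeting elsewhere
meet in one more point than required, since an element of one of them can be moved to the front;
hence their levels may be raised by one after deleting the point, and their total weight is at most
about k / n by induction. A member of positive level meets every set, which leaves about k² / n for
the members of level 0 avoiding the first point. The members containing the first point form, after
lowering the levels, a smaller instance. Unless all members lie in a star whose core size bounds
every level, summing these losses gives Φ ≤ (k³ + 2k² − k) / (2 (n − 1)) < 1.

In the case of equality the shifted labelling is therefore a full star, and it remains to see that
a labelling of which a single shift is a full star is itself a full star: two k-sets that would be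
moved differently are both in conflict with a third one, chosen to meet them in the core only.
-}

open import Defs
open import Data.Nat using (ℕ; _*_; _+_; _^_; _≤_)
open import Data.Rational using (1ℚ)
open import Data.Rational using () renaming (_≤_ to _≤ℚ_)
open import Data.List.Relation.Unary.Unique.Propositional using (Unique)
open import Data.Product using (Σ; _×_)
open import Relation.Binary.PropositionalEquality using (_≡_)
open import Function.Bundles using (_⇔_)

open import Data.Bool using (Bool; true; false; if_then_else_; _∧_; T)
open import Data.Bool.Properties using () renaming (_≟_ to _≟ᵇ_)
open import Data.Fin using (Fin; zero; suc)
open import Data.Fin.Properties using (any?)
open import Data.Fin.Subset using (Subset; inside; outside; ∣_∣; _∩_; _∪_; _∈_; _⊆_; _⊈_; ⊥; Empty)
open import Data.Fin.Subset.Properties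
import Data.Integer as ℤ
import Data.Integer.Properties as ℤ
open import Data.List using ([]; _∷_; foldr)
import Data.List.Membership.DecPropositional as DecMembership
open import Data.List.Membership.Propositional using () renaming (_∈_ to _∈ᶠ_)
open import Data.List.Relation.Unary.All.Properties using (All¬⇒¬Any)
open import Data.List.Relation.Unary.AllPairs using ([]; _∷_)
open import Data.List.Relation.Unary.Any using (here; there)
open import Data.Nat
open import Data.Nat.Combinatorics using (nCk+nC[k+1]≡[n+1]C[k+1]) renaming (_C_ to _choose_)
open import Data.Nat.Induction using (<-wellFounded)
open import Data.Nat.Properties
open import Data.Nat.Tactic.RingSolver using (solve-∀)
open import Data.Product using (∃; ∃-syntax; _,_; proj₁; proj₂)
open import Data.Rational using (ℚ; 0ℚ; toℚᵘ) renaming (_+_ to _+ℚ_; _/_ to _/ℚ_)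
import Data.Rational.Properties as ℚ
open import Data.Rational.Unnormalised using (mkℚᵘ; *≡*; *≤*)
import Data.Rational.Unnormalised as ℚᵘ
import Data.Rational.Unnormalised.Properties as ℚᵘ
open import Data.Sum using (_⊎_; inj₁; inj₂; [_,_]′)
open import Data.Vec as Vec using ([]; _∷_; lookup; _[_]≔_)
open import Data.Vec.Properties
  using ([]≔-lookup; []≔-idempotent; lookup∘update; []=⇒lookup; ≡-dec)
open import Function using (_∘_; _⟨_⟩_)
open import Function.Bundles using (mk⇔; Equivalence)
open import Induction.WellFounded using (Acc; acc)
open import Relation.Binary.PropositionalEquality
  using (_≢_; refl; sym; trans; cong; cong₂; subst; subst₂; module ≡-Reasoning)
open import Relation.Nullary using (Dec; yes; no; does; contradiction; ¬_)
open import Relation.Nullary.Decidable using (_×-dec_)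

-- Sums over all subsets

∑ : ∀ {n} → (Subset n → ℕ) → ℕ
∑ {zero}  φ = φ []
∑ {suc n} φ = ∑ (φ ∘ (outside ∷_)) + ∑ (φ ∘ (inside ∷_))

∑-cong : ∀ {n} {φ ψ : Subset n → ℕ} → (∀ A → φ A ≡ ψ A) → ∑ φ ≡ ∑ ψ
∑-cong {zero}  eq = eq []
∑-cong {suc n} eq = cong₂ _+_ (∑-cong (eq ∘ (outside ∷_))) (∑-cong (eq ∘ (inside ∷_)))

∑-mono : ∀ {n} {φ ψ : Subset n → ℕ} → (∀ A → φ A ≤ ψ A) → ∑ φ ≤ ∑ ψ
∑-mono {zero}  le = le []
∑-mono {suc n} le = +-mono-≤ (∑-mono (le ∘ (outside ∷_))) (∑-mono (le ∘ (inside ∷_)))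

∑-mono-< : ∀ {n} {φ ψ : Subset n → ℕ} → (∀ A → φ A ≤ ψ A) → ∀ A → φ A < ψ A → ∑ φ < ∑ ψ
∑-mono-< le []           lt = lt
∑-mono-< le (false ∷ A) lt = +-mono-<-≤ (∑-mono-< (le ∘ (outside ∷_)) A lt) (∑-mono (le ∘ (inside ∷_)))
∑-mono-< le (true  ∷ A) lt = +-mono-≤-< (∑-mono (le ∘ (outside ∷_))) (∑-mono-< (le ∘ (inside ∷_)) A lt)

∑-0 : ∀ n → ∑ {n} (λ _ → 0) ≡ 0
∑-0 zero    = refl
∑-0 (suc n) = cong₂ _+_ (∑-0 n) (∑-0 n)

+-interchange : ∀ a b c d → (a + b) + (c + d) ≡ (a + c) + (b + d)
+-interchange = solve-∀

∑-+ : ∀ {n} (φ ψ : Subset n → ℕ) → ∑ (λ A → φ A + ψ A) ≡ ∑ φ + ∑ ψ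
∑-+ {zero}  φ ψ = refl
∑-+ {suc n} φ ψ = trans
  (cong₂ _+_ (∑-+ (φ ∘ (outside ∷_)) (ψ ∘ (outside ∷_))) (∑-+ (φ ∘ (inside ∷_)) (ψ ∘ (inside ∷_))))
  (+-interchange (∑ (φ ∘ (outside ∷_))) (∑ (ψ ∘ (outside ∷_))) _ _)

∑-*ˡ : ∀ {n} c (φ : Subset n → ℕ) → ∑ (λ A → c * φ A) ≡ c * ∑ φ
∑-*ˡ {zero}  c φ = refl
∑-*ˡ {suc n} c φ = trans
  (cong₂ _+_ (∑-*ˡ c (φ ∘ (outside ∷_))) (∑-*ˡ c (φ ∘ (inside ∷_))))
  (sym (*-distribˡ-+ c (∑ (φ ∘ (outside ∷_))) _))

∑-linear : ∀ {n} a (φ : Subset n → ℕ) b ψ → ∑ (λ A → a * φ A + b * ψ A) ≡ a * ∑ φ + b * ∑ ψ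
∑-linear a φ b ψ = trans (∑-+ (λ A → a * φ A) (λ A → b * ψ A)) (cong₂ _+_ (∑-*ˡ a φ) (∑-*ˡ b ψ))

∑-≤-≡ : ∀ {n} {φ ψ : Subset n → ℕ} → (∀ A → φ A ≤ ψ A) → ∑ φ ≡ ∑ ψ → ∀ A → φ A ≡ ψ A
∑-≤-≡ le eq A with m≤n⇒m<n∨m≡n (le A)
... | inj₁ lt = contradiction (∑-mono-< le A lt) (<-irrefl eq)
... | inj₂ e  = e

layer : ∀ {n} → ℕ → (Subset n → ℕ) → Subset n → ℕ
layer k φ A = if ∣ A ∣ ≡ᵇ k then φ A else 0

layer-≡ : ∀ {n} k (φ : Subset n → ℕ) A → ∣ A ∣ ≡ k → layer k φ A ≡ φ A
layer-≡ k φ A refl with ∣ A ∣ ≡ᵇ ∣ A ∣ | ≡⇒≡ᵇ ∣ A ∣ ∣ A ∣ refl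
... | true | _ = refl

layer-*ˡ : ∀ {n} k c (φ : Subset n → ℕ) A → layer k (λ B → c * φ B) A ≡ c * layer k φ A
layer-*ˡ k c φ A with ∣ A ∣ ≡ᵇ k
... | true  = refl
... | false = sym (*-zeroʳ c)

layer-+ : ∀ {n} k (φ ψ : Subset n → ℕ) A → layer k (λ B → φ B + ψ B) A ≡ layer k φ A + layer k ψ A
layer-+ k φ ψ A with ∣ A ∣ ≡ᵇ k
... | true  = refl
... | false = refl

∑-layer-1 : ∀ n k → ∑ {n} (layer k (λ _ → 1)) ≡ n choose k
∑-layer-1 zero    zero    = refl
∑-layer-1 zero    (suc k) = refl
∑-layer-1 (suc n) zero    = cong₂ _+_ (∑-layer-1 n zero) (∑-0 n)
∑-layer-1 (suc n) (suc k) = trans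
  (cong₂ _+_ (∑-layer-1 n (suc k)) (∑-layer-1 n k))
  (trans (+-comm (n choose suc k) (n choose k)) (nCk+nC[k+1]≡[n+1]C[k+1] n k))

∑-layer-0-∩ : ∀ {n} (D : Subset n) → ∑ (layer 0 (λ A → ∣ A ∩ D ∣)) ≡ 0
∑-layer-0-∩ {n} D = trans (∑-cong vanishes) (∑-0 n)
  where
  vanishes : ∀ A → layer 0 (λ A → ∣ A ∩ D ∣) A ≡ 0
  vanishes A with ∣ A ∣ in eq
  ... | zero  = n≤0⇒n≡0 (≤-trans (∣p∩q∣≤∣p∣ A D) (≤-reflexive eq))
  ... | suc _ = refl

-- Double counting: each point of `D` lies in `m choose k` of the sets with `suc k` elements. The
-- induction on the ground set reassembles these numbers by Pascal's rule.
∑-layer-∩ : ∀ {m} k (D : Subset (suc m)) →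
  ∑ (layer (suc k) (λ A → ∣ A ∩ D ∣)) ≡ ∣ D ∣ * (m choose k)
∑-layer-∩ {zero}  zero    (true  ∷ []) = refl
∑-layer-∩ {zero}  zero    (false ∷ []) = refl
∑-layer-∩ {zero}  (suc k) (true  ∷ []) = refl
∑-layer-∩ {zero}  (suc k) (false ∷ []) = refl
∑-layer-∩ {suc m} zero (true ∷ D) = trans
  (cong₂ _+_ (∑-layer-∩ zero D)
    (trans (∑-cong (layer-+ 0 (λ _ → 1) (λ A → ∣ A ∩ D ∣)))
    (trans (∑-+ (layer 0 (λ _ → 1)) (layer 0 (λ A → ∣ A ∩ D ∣)))
           (cong₂ _+_ (∑-layer-1 (suc m) 0) (∑-layer-0-∩ D)))))
  (+-comm (∣ D ∣ * 1) 1)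
∑-layer-∩ {suc m} zero (false ∷ D) = trans
  (cong₂ _+_ (∑-layer-∩ zero D) (∑-layer-0-∩ D))
  (+-identityʳ _)
∑-layer-∩ {suc m} (suc k) (true ∷ D) = trans
  (cong₂ _+_ (∑-layer-∩ (suc k) D)
    (trans (∑-cong (layer-+ (suc k) (λ _ → 1) (λ A → ∣ A ∩ D ∣)))
    (trans (∑-+ (layer (suc k) (λ _ → 1)) (layer (suc k) (λ A → ∣ A ∩ D ∣)))
           (cong₂ _+_ (∑-layer-1 (suc m) (suc k)) (∑-layer-∩ k D)))))
  (trans (regroup ∣ D ∣ (m choose suc k) (suc m choose suc k) (m choose k))
         (cong (λ c → suc m choose suc k + ∣ D ∣ * c) (nCk+nC[k+1]≡[n+1]C[k+1] m k)))
  where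
  regroup : ∀ d x y z → d * x + (y + d * z) ≡ y + d * (z + x)
  regroup = solve-∀
∑-layer-∩ {suc m} (suc k) (false ∷ D) = trans
  (cong₂ _+_ (∑-layer-∩ (suc k) D) (∑-layer-∩ k D))
  (trans (regroup ∣ D ∣ (m choose suc k) (m choose k)) (cong (∣ D ∣ *_) (nCk+nC[k+1]≡[n+1]C[k+1] m k)))
  where
  regroup : ∀ d x z → d * x + d * z ≡ d * (z + x)
  regroup = solve-∀

-- Weights of levels

fall : ℕ → ℕ → ℕ
fall n       zero    = 1
fall zero    (suc k) = 0
fall (suc n) (suc k) = suc n * fall n k

-- Pascal's rule multiplied by `(suc k) !`; the right side is `fall (suc n) (suc k)` by definition.
fall-pascal : ∀ n k → fall n (suc k) + suc k * fall n k ≡ suc n * fall n k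
fall-pascal zero    zero    = refl
fall-pascal zero    (suc k) = *-zeroʳ (suc (suc k))
fall-pascal (suc n) zero    = solve-1 n
  where
  solve-1 : ∀ n → suc n * 1 + 1 * 1 ≡ suc (suc n) * 1
  solve-1 = solve-∀
fall-pascal (suc n) (suc k) = trans
  (factor (suc n) (suc k) (fall n (suc k)) (fall n k))
  (trans (cong (λ x → suc n * x + suc n * fall n k) (fall-pascal n k)) (unfactor (suc n) (fall n k)))
  where
  factor : ∀ n k x y → n * x + suc k * (n * y) ≡ n * (x + k * y) + n * y
  factor = solve-∀
  unfactor : ∀ n y → n * (n * y) + n * y ≡ suc n * (n * y)
  unfactor = solve-∀

C*!≡fall : ∀ n k → (n choose k) * k ! ≡ fall n k
C*!≡fall zero    zero    = refl
C*!≡fall zero    (suc k) = refl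
C*!≡fall (suc n) zero    = refl
C*!≡fall (suc n) (suc k) = begin
  (suc n choose suc k) * (suc k) !
    ≡⟨ cong (_* (suc k) !) (sym (nCk+nC[k+1]≡[n+1]C[k+1] n k)) ⟩
  (n choose k + n choose suc k) * (suc k * k !)
    ≡⟨ regroup (n choose k) (n choose suc k) (suc k) (k !) ⟩
  (n choose suc k) * (suc k) ! + suc k * ((n choose k) * k !)
    ≡⟨ cong₂ (λ x y → x + suc k * y) (C*!≡fall n (suc k)) (C*!≡fall n k) ⟩
  fall n (suc k) + suc k * fall n k
    ≡⟨ fall-pascal n k ⟩
  suc n * fall n k ∎
  where
  open ≡-Reasoning
  regroup : ∀ x y s f → (x + y) * (s * f) ≡ y * (s * f) + s * (x * f)
  regroup = solve-∀

fall-pos : ∀ {n k} → k ≤ n → 0 < fall n k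
fall-pos {k = zero} z≤n       = s≤s z≤n
fall-pos (s≤s {k} {n} k≤n) = *-mono-≤ (s≤s (z≤n {n})) (fall-pos k≤n)

fall-monoˡ : ∀ {m n} → m ≤ n → ∀ k → fall m k ≤ fall n k
fall-monoˡ m≤n       zero    = ≤-refl
fall-monoˡ z≤n       (suc k) = z≤n
fall-monoˡ (s≤s m≤n) (suc k) = *-mono-≤ (s≤s m≤n) (fall-monoˡ m≤n k)

fall-suc-≤ : ∀ n k → fall n (suc k) ≤ n * fall n k
fall-suc-≤ n k = +-cancelʳ-≤ (fall n k) _ _ (begin
  fall n (suc k) + fall n k          ≤⟨ +-monoʳ-≤ (fall n (suc k)) (m≤n*m (fall n k) (suc k)) ⟩
  fall n (suc k) + suc k * fall n k  ≡⟨ fall-pascal n k ⟩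
  suc n * fall n k                   ≡⟨ +-comm (fall n k) (n * fall n k) ⟩
  n * fall n k + fall n k            ∎)
  where open ≤-Reasoning

-- For j ≤ k ≤ n this is (k − j)! · n (n − 1) ⋯ (n − j + 1) = fall n k / C(n − j, k − j),
-- so that clearing the common denominator fall n k keeps all sums in ℕ.
levelWeight : ℕ → ℕ → ℕ → ℕ
levelWeight n       k       zero    = k !
levelWeight (suc n) (suc k) (suc j) = suc n * levelWeight n k j
levelWeight zero    k       (suc j) = 0
levelWeight (suc n) zero    (suc j) = 0

C*levelWeight≡fall : ∀ n k j → j ≤ k → k ≤ n → ((n ∸ j) choose (k ∸ j)) * levelWeight n k j ≡ fall n k
C*levelWeight≡fall n       k       zero    j≤k       k≤n       = C*!≡fall n k
C*levelWeight≡fall (suc n) (suc k) (suc j) (s≤s j≤k) (s≤s k≤n) = trans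
  (x*[y*z] ((n ∸ j) choose (k ∸ j)) (suc n) (levelWeight n k j))
  (cong (suc n *_) (C*levelWeight≡fall n k j j≤k k≤n))
  where
  x*[y*z] : ∀ x y z → x * (y * z) ≡ y * (x * z)
  x*[y*z] = solve-∀

levelWeight-pos : ∀ {n k j} → j ≤ k → k ≤ n → 0 < levelWeight n k j
levelWeight-pos {k = k} z≤n k≤n = 1≤n! k
levelWeight-pos (s≤s j≤k) (s≤s {n = n} k≤n) = *-mono-≤ (s≤s (z≤n {n})) (levelWeight-pos j≤k k≤n)

-- One level up from `i`, the factor `k − i` of the factorial gives way to `n − i`, which is larger
-- since `k < n`.
levelWeight-mono-< : ∀ {n k i j} → i < j → j ≤ k → k < n → levelWeight n k i < levelWeight n k j
levelWeight-mono-< {suc n} {suc k} {zero} {suc zero} (s≤s _) _ (s≤s k<n) =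
  *-monoˡ-< (k !) {{>-nonZero (1≤n! k)}} (s≤s k<n)
levelWeight-mono-< {suc n} {suc k} {zero} {suc (suc j)} (s≤s _) (s≤s j≤k) (s≤s k<n) = <-trans
  (levelWeight-mono-< {suc n} {suc k} {zero} {suc zero} (s≤s z≤n) (s≤s z≤n) (s≤s k<n))
  (*-monoʳ-< (suc n) (levelWeight-mono-< {n} {k} {zero} {suc j} (s≤s z≤n) j≤k k<n))
levelWeight-mono-< {suc n} {suc k} {suc i} {suc j} (s≤s i<j) (s≤s j≤k) (s≤s k<n) =
  *-monoʳ-< (suc n) (levelWeight-mono-< i<j j≤k k<n)

levelWeight-mono : ∀ {n k i j} → i ≤ j → j ≤ k → k < n → levelWeight n k i ≤ levelWeight n k j
levelWeight-mono i≤j j≤k k<n with m≤n⇒m<n∨m≡n i≤j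
... | inj₁ i<j  = <⇒≤ (levelWeight-mono-< i<j j≤k k<n)
... | inj₂ refl = ≤-refl

private
  -- Divided by both values of `fall` and cleared of binomials this reads `(n + 1) C(n − i − 1, k −
  -- i − 1) ≤ k C(n + 1 − i, k − i)`. The induction lowers `n`, `k` and `i` together until the level
  -- is 0.
  levelWeight-descend : ∀ n k i → i < k → k ≤ n →
    suc n * fall n k * levelWeight (suc n) k i ≤ k * fall (suc n) k * levelWeight n k (suc i)
  levelWeight-descend (suc n) (suc k) zero i<k k≤n = begin
    suc (suc n) * fall (suc n) (suc k) * (suc k * k !)
      ≤⟨ *-monoˡ-≤ (suc k * k !) (*-monoʳ-≤ (suc (suc n)) (fall-suc-≤ (suc n) k)) ⟩
    suc (suc n) * (suc n * fall (suc n) k) * (suc k * k !)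
      ≡⟨ regroup (suc (suc n)) (suc n) (fall (suc n) k) (suc k) (k !) ⟩
    suc k * (suc (suc n) * fall (suc n) k) * (suc n * k !) ∎
    where
    open ≤-Reasoning
    regroup : ∀ a b c d e → a * (b * c) * (d * e) ≡ d * (a * c) * (b * e)
    regroup = solve-∀
  levelWeight-descend (suc n) (suc k) (suc i) (s≤s i<k) (s≤s k≤n) = begin
    suc (suc n) * (suc n * P) * (suc (suc n) * Q)
      ≡⟨ regroup₁ (suc n) P Q ⟩
    suc (suc n) * suc n * (suc n * P * Q + P * Q)
      -- The new factor is split as `suc n + 1`: `suc n` copies of `P * Q` are bounded by the
      -- induction hypothesis, and the single one by the same inequality divided by `suc n`, where
      -- `k ≤ suc n` enters.
      ≤⟨ *-monoʳ-≤ (suc (suc n) * suc n) (+-mono-≤ ih (*-cancelˡ-≤ (suc n) ih′)) ⟩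
    suc (suc n) * suc n * (k * R * S + R * S)
      ≡⟨ regroup₂ (suc (suc n)) (suc n) k R S ⟩
    suc k * (suc (suc n) * R) * (suc n * S) ∎
    where
    open ≤-Reasoning
    P = fall n k
    Q = levelWeight (suc n) k i
    R = fall (suc n) k
    S = levelWeight n k (suc i)
    ih : suc n * P * Q ≤ k * R * S
    ih = levelWeight-descend n k i i<k k≤n
    ih′ : suc n * (P * Q) ≤ suc n * (R * S)
    ih′ = begin
      suc n * (P * Q) ≡⟨ sym (*-assoc (suc n) P Q) ⟩
      suc n * P * Q   ≤⟨ ih ⟩
      k * R * S       ≡⟨ *-assoc k R S ⟩
      k * (R * S)     ≤⟨ *-monoˡ-≤ (R * S) (m≤n⇒m≤1+n k≤n) ⟩
      suc n * (R * S) ∎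
    regroup₁ : ∀ b p q → suc b * (b * p) * (suc b * q) ≡ suc b * b * (b * p * q + p * q)
    regroup₁ = solve-∀
    regroup₂ : ∀ a b k r s → a * b * (k * r * s + r * s) ≡ suc k * (a * r) * (b * s)
    regroup₂ = solve-∀

-- Relative to the common denominators fall, deleting a point that a set avoids, while raising
-- its level by one, multiplies the weight by at least m / k.
levelWeight-avoid : ∀ m k j → 1 ≤ j → j ≤ k → k < m →
  m * fall m (suc k) * levelWeight (suc m) (suc k) j
    ≤ k * fall (suc m) (suc k) * levelWeight m (suc k) (suc j)
levelWeight-avoid (suc m) k (suc i) _ i<k (s≤s k≤m) = begin
  suc m * (suc m * fall m k) * (suc (suc m) * levelWeight (suc m) k i)
    ≡⟨ regroup₁ (suc m) (fall m k) (suc (suc m)) (levelWeight (suc m) k i) ⟩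
  suc m * suc (suc m) * (suc m * fall m k * levelWeight (suc m) k i)
    ≤⟨ *-monoʳ-≤ (suc m * suc (suc m)) (levelWeight-descend m k i i<k k≤m) ⟩
  suc m * suc (suc m) * (k * fall (suc m) k * levelWeight m k (suc i))
    ≡⟨ regroup₂ (suc m) (suc (suc m)) k (fall (suc m) k) (levelWeight m k (suc i)) ⟩
  k * (suc (suc m) * fall (suc m) k) * (suc m * levelWeight m k (suc i)) ∎
  where
  open ≤-Reasoning
  regroup₁ : ∀ a p b q → a * (a * p) * (b * q) ≡ a * b * (a * p * q)
  regroup₁ = solve-∀
  regroup₂ : ∀ a b k r s → a * b * (k * r * s) ≡ k * (b * r) * (a * s)
  regroup₂ = solve-∀

-- A label 0 marks an absent set, a label suc j a set of level j.
labelWeight : ℕ → ℕ → ℕ → ℕ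
labelWeight n k zero    = 0
labelWeight n k (suc j) = levelWeight n k j

totalWeight : (n k : ℕ) → (Subset n → ℕ) → ℕ
totalWeight n k f = ∑ (λ A → labelWeight n k (f A))

-- Shifting

-- An element of Swap n is a pair of positions, lower < higher.
data Swap : ℕ → Set where
  here  : ∀ {n} → Fin n → Swap (suc n)
  there : ∀ {n} → Swap n → Swap (suc n)

swap : ∀ {n} → Swap n → Subset n → Subset n
swap (here j)  (x ∷ A) = lookup A j ∷ (A [ j ]≔ x)
swap (there p) (x ∷ A) = x ∷ swap p A

lower higher : ∀ {n} → Swap n → Subset n → Bool
lower  (here j)  (x ∷ A) = x
lower  (there p) (x ∷ A) = lower p A
higher (here j)  (x ∷ A) = lookup A j
higher (there p) (x ∷ A) = higher p A

swap-involutive : ∀ {n} (p : Swap n) A → swap p (swap p A) ≡ A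
swap-involutive (here j)  (x ∷ A) = cong₂ _∷_ (lookup∘update j A x)
  (trans ([]≔-idempotent A j) ([]≔-lookup A j))
swap-involutive (there p) (x ∷ A) = cong (x ∷_) (swap-involutive p A)

lower-swap : ∀ {n} (p : Swap n) A → lower p (swap p A) ≡ higher p A
lower-swap (here j)  (x ∷ A) = refl
lower-swap (there p) (x ∷ A) = lower-swap p A

higher-swap : ∀ {n} (p : Swap n) A → higher p (swap p A) ≡ lower p A
higher-swap (here j)  (x ∷ A) = lookup∘update j A x
higher-swap (there p) (x ∷ A) = higher-swap p A

swap-fixes : ∀ {n} (p : Swap n) A → lower p A ≡ higher p A → swap p A ≡ A
swap-fixes (here j)  (x ∷ A) refl = cong (lookup A j ∷_) ([]≔-lookup A j)
swap-fixes (there p) (x ∷ A) eq   = cong (x ∷_) (swap-fixes p A eq)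

swap-∩ : ∀ {n} (p : Swap n) A B → swap p A ∩ swap p B ≡ swap p (A ∩ B)
swap-∩ (here zero)    (x ∷ a ∷ A) (y ∷ b ∷ B) = refl
swap-∩ (here (suc j)) (x ∷ a ∷ A) (y ∷ b ∷ B)
  with eq ← swap-∩ (here j) (x ∷ A) (y ∷ B) =
  cong₂ _∷_ (cong Vec.head eq) (cong ((a ∧ b) ∷_) (cong Vec.tail eq))
swap-∩ (there p) (x ∷ A) (y ∷ B) = cong ((x ∧ y) ∷_) (swap-∩ p A B)

∣∷∷∣-comm : ∀ x y {n} (A : Subset n) → ∣ x ∷ y ∷ A ∣ ≡ ∣ y ∷ x ∷ A ∣
∣∷∷∣-comm true  true  A = refl
∣∷∷∣-comm true  false A = refl
∣∷∷∣-comm false true  A = refl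
∣∷∷∣-comm false false A = refl

∣∷∣-cong : ∀ x {n} (A B : Subset n) → ∣ A ∣ ≡ ∣ B ∣ → ∣ x ∷ A ∣ ≡ ∣ x ∷ B ∣
∣∷∣-cong true  A B eq = cong suc eq
∣∷∣-cong false A B eq = eq

∣swap∣ : ∀ {n} (p : Swap n) A → ∣ swap p A ∣ ≡ ∣ A ∣
∣swap∣ (here zero)    (x ∷ y ∷ A) = ∣∷∷∣-comm y x A
∣swap∣ (here (suc j)) (x ∷ y ∷ A) = begin
  ∣ lookup A j ∷ y ∷ (A [ j ]≔ x) ∣ ≡⟨ ∣∷∷∣-comm (lookup A j) y (A [ j ]≔ x) ⟩
  ∣ y ∷ lookup A j ∷ (A [ j ]≔ x) ∣ ≡⟨ ∣∷∣-cong y (lookup A j ∷ (A [ j ]≔ x)) (x ∷ A) (∣swap∣ (here j) (x ∷ A)) ⟩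
  ∣ y ∷ x ∷ A ∣                     ≡⟨ ∣∷∷∣-comm y x A ⟩
  ∣ x ∷ y ∷ A ∣                     ∎
  where open ≡-Reasoning
∣swap∣ (there p) (x ∷ A) = ∣∷∣-cong x (swap p A) A (∣swap∣ p A)

∣swap∩swap∣ : ∀ {n} (p : Swap n) A B → ∣ swap p A ∩ swap p B ∣ ≡ ∣ A ∩ B ∣
∣swap∩swap∣ p A B = trans (cong ∣_∣ (swap-∩ p A B)) (∣swap∣ p (A ∩ B))

∣swap∩∣ : ∀ {n} (p : Swap n) A B → ∣ swap p A ∩ B ∣ ≡ ∣ A ∩ swap p B ∣
∣swap∩∣ p A B = begin
  ∣ swap p A ∩ B ∣                   ≡⟨ cong (λ C → ∣ swap p A ∩ C ∣) (sym (swap-involutive p B)) ⟩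
  ∣ swap p A ∩ swap p (swap p B) ∣   ≡⟨ ∣swap∩swap∣ p A (swap p B) ⟩
  ∣ A ∩ swap p B ∣                   ∎
  where open ≡-Reasoning

-- Either `B` contains both points and is fixed, or it loses the common lower point and gains at
-- most one new common point, the higher one.
∩-swap-≤ : ∀ {n} (p : Swap n) A B → lower p A ≡ true → lower p B ≡ true →
  ∣ A ∩ swap p B ∣ ≤ ∣ A ∩ B ∣
∩-swap-≤ (here j) (true ∷ A) (true ∷ B) refl refl with lookup B j in eq
... | true = ≤-reflexive (cong (λ C → suc ∣ A ∩ C ∣) (trans (cong (B [ j ]≔_) (sym eq)) ([]≔-lookup B j)))
... | false = add-one A B j
  where
  add-one : ∀ {n} (A B : Subset n) j → ∣ A ∩ (B [ j ]≔ true) ∣ ≤ suc ∣ A ∩ B ∣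
  add-one (true  ∷ A) (true  ∷ B) zero = n≤1+n _
  add-one (true  ∷ A) (false ∷ B) zero = ≤-refl
  add-one (false ∷ A) (b     ∷ B) zero = n≤1+n _
  add-one (true  ∷ A) (true  ∷ B) (suc j) = s≤s (add-one A B j)
  add-one (true  ∷ A) (false ∷ B) (suc j) = add-one A B j
  add-one (false ∷ A) (b     ∷ B) (suc j) = add-one A B j
∩-swap-≤ (there p) (true  ∷ A) (true  ∷ B) a b = s≤s (∩-swap-≤ p A B a b)
∩-swap-≤ (there p) (true  ∷ A) (false ∷ B) a b = ∩-swap-≤ p A B a b
∩-swap-≤ (there p) (false ∷ A) (y     ∷ B) a b = ∩-swap-≤ p A B a b

∑-swap : ∀ {n} (p : Swap n) (φ : Subset n → ℕ) → ∑ (φ ∘ swap p) ≡ ∑ φ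
∑-swap {suc (suc n)} (here zero) φ = +-interchange
  (∑ λ A → φ (outside ∷ outside ∷ A)) (∑ λ A → φ (inside ∷ outside ∷ A)) _ _
-- The second point is not moved. Once it is fixed, what remains is a swap of the first point with a
-- position that is nearer by one.
∑-swap {suc (suc n)} (here (suc j)) φ = begin
  (swapped outside outside + swapped inside outside) + (swapped outside inside + swapped inside inside)
    ≡⟨ +-interchange (swapped outside outside) (swapped inside outside) _ _ ⟩
  (swapped outside outside + swapped outside inside) + (swapped inside outside + swapped inside inside)
    ≡⟨ cong₂ _+_ (∑-swap (here j) (φ′ outside)) (∑-swap (here j) (φ′ inside)) ⟩
  (plain outside outside + plain outside inside) + (plain inside outside + plain inside inside)
    ≡⟨ +-interchange (plain outside outside) (plain outside inside) _ _ ⟩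
  (plain outside outside + plain inside outside) + (plain outside inside + plain inside inside) ∎
  where
  open ≡-Reasoning
  φ′ : Bool → Subset (suc n) → ℕ
  φ′ y (x ∷ A) = φ (x ∷ y ∷ A)
  swapped plain : Bool → Bool → ℕ
  swapped y x = ∑ λ A → φ (lookup A j ∷ y ∷ (A [ j ]≔ x))
  plain y x = ∑ λ A → φ (x ∷ y ∷ A)
∑-swap (there p) φ = cong₂ _+_ (∑-swap p (φ ∘ (outside ∷_))) (∑-swap p (φ ∘ (inside ∷_)))

-- Reduces a comparison of sums to one on each pair `A`, `swap p A`; counting every term twice
-- avoids choosing representatives.
∑-paired : ∀ {n} (p : Swap n) (φ : Subset n → ℕ) → ∑ (λ A → φ A + φ (swap p A)) ≡ 2 * ∑ φ
∑-paired p φ = begin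
  ∑ (λ A → φ A + φ (swap p A)) ≡⟨ ∑-+ φ (φ ∘ swap p) ⟩
  ∑ φ + ∑ (φ ∘ swap p)         ≡⟨ cong (∑ φ +_) (trans (∑-swap p φ) (sym (+-identityʳ (∑ φ)))) ⟩
  2 * ∑ φ                      ∎
  where open ≡-Reasoning

-- Testing the lower point alone is enough: a set containing both points or neither is fixed by
-- `swap p`, and there maximum and minimum agree.
shift : ∀ {n} → Swap n → (Subset n → ℕ) → Subset n → ℕ
shift p f A = if lower p A then f A ⊔ f (swap p A) else f A ⊓ f (swap p A)

shift-⊔ : ∀ {n} (p : Swap n) f A → lower p A ≡ true → shift p f A ≡ f A ⊔ f (swap p A)
shift-⊔ p f A lo rewrite lo = refl

shift-⊓ : ∀ {n} (p : Swap n) f A → lower p A ≡ false → shift p f A ≡ f A ⊓ f (swap p A)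
shift-⊓ p f A lo rewrite lo = refl

shift-pair : ∀ {n} (p : Swap n) (f : Subset n → ℕ) A →
  (shift p f A ≡ f A × shift p f (swap p A) ≡ f (swap p A)) ⊎
  (shift p f A ≡ f (swap p A) × shift p f (swap p A) ≡ f A)
shift-pair p f A with lower p A in lo | higher p A in hi
... | true | true
  rewrite lower-swap p A | hi | swap-involutive p A | swap-fixes p A (trans lo (sym hi)) =
  inj₁ (⊔-idem (f A) , ⊔-idem (f A))
... | false | false
  rewrite lower-swap p A | hi | swap-involutive p A | swap-fixes p A (trans lo (sym hi)) =
  inj₁ (⊓-idem (f A) , ⊓-idem (f A))
... | true | false rewrite lower-swap p A | hi | swap-involutive p A with ≤-total (f A) (f (swap p A))
...   | inj₁ le = inj₂ (m≤n⇒m⊔n≡n le , m≥n⇒m⊓n≡n le)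
...   | inj₂ ge = inj₁ (m≥n⇒m⊔n≡m ge , m≤n⇒m⊓n≡m ge)
shift-pair p f A | false | true rewrite lower-swap p A | hi | swap-involutive p A with ≤-total (f A) (f (swap p A))
...   | inj₁ le = inj₁ (m≤n⇒m⊓n≡m le , m≥n⇒m⊔n≡m le)
...   | inj₂ ge = inj₂ (m≥n⇒m⊓n≡n ge , m≤n⇒m⊔n≡n ge)

∑-shift : ∀ {n} (p : Swap n) (ω : ℕ → ℕ) (f : Subset n → ℕ) → ∑ (ω ∘ shift p f) ≡ ∑ (ω ∘ f)
∑-shift p ω f = *-cancelˡ-≡ _ _ 2
  (trans (sym (∑-paired p (ω ∘ shift p f))) (trans (∑-cong pointwise) (∑-paired p (ω ∘ f))))
  where
  pointwise : ∀ A → ω (shift p f A) + ω (shift p f (swap p A)) ≡ ω (f A) + ω (f (swap p A))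
  pointwise A with shift-pair p f A
  ... | inj₁ (e , e′) = cong₂ (λ x y → ω x + ω y) e e′
  ... | inj₂ (e , e′) = trans (cong₂ (λ x y → ω x + ω y) e e′) (+-comm (ω (f (swap p A))) (ω (f A)))

-- A label is one more than a level, hence the `suc` in `meet`. With `A` in place of `B` the
-- condition bounds every level by `k`.
record Labelling {n} (k : ℕ) (f : Subset n → ℕ) : Set where
  field
    size : ∀ {A} → 0 < f A → ∣ A ∣ ≡ k
    meet : ∀ {A B} → 0 < f A → 0 < f B → f A ≤ suc ∣ A ∩ B ∣
open Labelling public

private
  -- A minimum is a lower bound for the labels of both `A` and `swap p A`, so either set may stand
  -- in for `A`. A maximum is attained at only one of them, but then `A` contains the lower point.
  data MinView {n} (p : Swap n) (f : Subset n → ℕ) (A : Subset n) : Set where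
    low  : shift p f A ≤ f A → shift p f A ≤ f (swap p A) → MinView p f A
    high : lower p A ≡ true → shift p f A ≡ f A ⊎ shift p f A ≡ f (swap p A) → MinView p f A

  minView : ∀ {n} (p : Swap n) f A → MinView p f A
  minView p f A with lower p A in lo
  ... | false = low (≤-trans (≤-reflexive (shift-⊓ p f A lo)) (m⊓n≤m _ _))
                    (≤-trans (≤-reflexive (shift-⊓ p f A lo)) (m⊓n≤n (f A) _))
  ... | true with ⊔-sel (f A) (f (swap p A))
  ...   | inj₁ e = high lo (inj₁ (trans (shift-⊔ p f A lo) e))
  ...   | inj₂ e = high lo (inj₂ (trans (shift-⊔ p f A lo) e))

-- If one label is a minimum, its set can be swapped or not to match the other one, and swapping
-- both keeps the intersection size. The remaining mixed case has two maxima; both sets then contain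
-- the lower point and `∩-swap-≤` applies.
shift-labelling : ∀ {n k} (p : Swap n) {f : Subset n → ℕ} → Labelling k f → Labelling k (shift p f)
shift-labelling {n} {k} p {f} L = record { size = size′ ; meet = meet′ _ _ }
  where
  size′ : ∀ {A} → 0 < shift p f A → ∣ A ∣ ≡ k
  size′ {A} pos with shift-pair p f A
  ... | inj₁ (e , _) = size L (subst (0 <_) e pos)
  ... | inj₂ (e , _) = trans (sym (∣swap∣ p A)) (size L (subst (0 <_) e pos))

  meet′ : ∀ A B → 0 < shift p f A → 0 < shift p f B → shift p f A ≤ suc ∣ A ∩ B ∣
  meet′ A B a b with minView p f A | minView p f B
  ... | low a₁ a₂ | low b₁ _ = ≤-trans a₁ (meet L (≤-trans a a₁) (≤-trans b b₁))
  ... | low a₁ a₂ | high _ (inj₁ eb) = ≤-trans a₁ (meet L (≤-trans a a₁) (subst (0 <_) eb b))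
  ... | low a₁ a₂ | high _ (inj₂ eb) = ≤-trans a₂ (≤-trans (meet L (≤-trans a a₂) (subst (0 <_) eb b))
                                              (s≤s (≤-reflexive (∣swap∩swap∣ p A B))))
  ... | high _ (inj₁ ea) | low b₁ b₂ = ≤-trans (≤-reflexive ea) (meet L (subst (0 <_) ea a) (≤-trans b b₁))
  ... | high _ (inj₂ ea) | low b₁ b₂ = ≤-trans (≤-reflexive ea) (≤-trans (meet L (subst (0 <_) ea a) (≤-trans b b₂))
                                              (s≤s (≤-reflexive (∣swap∩swap∣ p A B))))
  ... | high _ (inj₁ ea) | high _ (inj₁ eb) =
    ≤-trans (≤-reflexive ea) (meet L (subst (0 <_) ea a) (subst (0 <_) eb b))
  ... | high _ (inj₂ ea) | high _ (inj₂ eb) =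
    ≤-trans (≤-reflexive ea) (≤-trans (meet L (subst (0 <_) ea a) (subst (0 <_) eb b))
                                      (s≤s (≤-reflexive (∣swap∩swap∣ p A B))))
  ... | high la (inj₁ ea) | high lb (inj₂ eb) =
    ≤-trans (≤-reflexive ea) (≤-trans (meet L (subst (0 <_) ea a) (subst (0 <_) eb b))
                                      (s≤s (∩-swap-≤ p A B la lb)))
  ... | high la (inj₂ ea) | high lb (inj₁ eb) =
    ≤-trans (≤-reflexive ea) (≤-trans (meet L (subst (0 <_) ea a) (subst (0 <_) eb b))
                                      (s≤s (≤-trans (≤-reflexive (∣swap∩∣ p A B)) (∩-swap-≤ p A B la lb))))

Shifted : ∀ {n} → (Subset n → ℕ) → Set
Shifted f = ∀ p A → lower p A ≡ false → higher p A ≡ true → f A ≤ f (swap p A)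

anySwap? : ∀ {n} {P : Swap n → Set} → (∀ p → Dec (P p)) → Dec (∃ P)
anySwap? {zero}  P? = no λ { (() , _) }
anySwap? {suc n} P? with any? (P? ∘ here) | anySwap? (P? ∘ there)
... | yes (j , Pj) | _            = yes (here j , Pj)
... | no _         | yes (p , Pp) = yes (there p , Pp)
... | no ¬h        | no ¬t        = no λ { (here j , Pj) → ¬h (j , Pj) ; (there p , Pp) → ¬t (p , Pp) }

Unshifted : ∀ {n} → (Subset n → ℕ) → Swap n → Set
Unshifted f p = ∃[ A ] (lower p A ≡ false × higher p A ≡ true × f (swap p A) < f A)

shifted-or-not : ∀ {n} (f : Subset n → ℕ) → Shifted f ⊎ ∃ (Unshifted f)
shifted-or-not f with anySwap? (λ p → anySubset? (λ A →
  (lower p A ≟ᵇ false) ×-dec (higher p A ≟ᵇ true) ×-dec (f (swap p A) <? f A)))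
... | yes w = inj₂ w
... | no ¬w = inj₁ λ p A lo hi → ≮⇒≥ λ lt → ¬w (p , A , lo , hi , lt)

-- The sum of the zero-based positions of the elements; it makes the energy below drop under
-- every shift that changes f.
position : ∀ {n} → Subset n → ℕ
position []      = 0
position (x ∷ A) = ∣ A ∣ + position A

position-swap : ∀ {n} (p : Swap n) A → lower p A ≡ false → higher p A ≡ true →
  position (swap p A) < position A
position-swap (here j) (false ∷ A) refl hi = +-mono-<-≤
  (≤-reflexive (trans (cong (λ b → ∣ b ∷ (A [ j ]≔ false) ∣) (sym hi)) (∣swap∣ (here j) (false ∷ A))))
  (remove A j)
  where
  ∣remove∣ : ∀ {n} (A : Subset n) j → ∣ A [ j ]≔ false ∣ ≤ ∣ A ∣
  ∣remove∣ (true  ∷ A) zero    = n≤1+n _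
  ∣remove∣ (false ∷ A) zero    = ≤-refl
  ∣remove∣ (true  ∷ A) (suc j) = s≤s (∣remove∣ A j)
  ∣remove∣ (false ∷ A) (suc j) = ∣remove∣ A j
  remove : ∀ {n} (A : Subset n) j → position (A [ j ]≔ false) ≤ position A
  remove (x ∷ A) zero    = ≤-refl
  remove (x ∷ A) (suc j) = +-mono-≤ (∣remove∣ A j) (remove A j)
position-swap (there p) (x ∷ A) lo hi = +-mono-≤-< (≤-reflexive (∣swap∣ p A)) (position-swap p A lo hi)

energy : ∀ {n} → (Subset n → ℕ) → ℕ
energy f = ∑ (λ A → f A * position A)

-- Two-term rearrangement: the sides differ by `(q − p) (b − a)`.
exchange-< : ∀ {a b p q} → p < q → a < b → b * p + a * q < a * p + b * q
exchange-< {a} {p = p} p<q a<b with m≤n⇒∃[o]m+o≡n p<q | m≤n⇒∃[o]m+o≡n a<b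
... | d , refl | e , refl = subst₂ _<_ (sym (left a p d e)) (sym (right a p d e)) (m<m+n _ (s≤s z≤n))
  where
  left : ∀ a p d e → (suc a + e) * p + a * (suc p + d) ≡ a * p + a * p + e * p + p + a * suc d
  left = solve-∀
  right : ∀ a p d e → a * p + (suc a + e) * (suc p + d) ≡ (a * p + a * p + e * p + p + a * suc d) + suc (d + e * suc d)
  right = solve-∀

-- On each pair the larger label moves to the smaller position. By rearrangement no pair gains
-- energy, and the pair of the witness loses some.
energy-shift : ∀ {n} (p : Swap n) (f : Subset n → ℕ) → Unshifted f p → energy (shift p f) < energy f
energy-shift p f (A , lo , hi , lt) = *-cancelˡ-< 2 _ _ (subst₂ _<_
  (∑-paired p (λ B → shift p f B * position B)) (∑-paired p (λ B → f B * position B))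
  (∑-mono-< pointwise A (strict A lo hi lt)))
  where
  pair : (Subset _ → ℕ) → Subset _ → ℕ
  pair g B = g B * position B + g (swap p B) * position (swap p B)

  raise : ∀ B → lower p B ≡ false → higher p B ≡ true → shift p f (swap p B) ≡ f (swap p B) ⊔ f B
  raise B lo hi = trans (shift-⊔ p f (swap p B) (trans (lower-swap p B) hi))
                        (cong (λ C → f (swap p B) ⊔ f C) (swap-involutive p B))

  strict : ∀ B → lower p B ≡ false → higher p B ≡ true → f (swap p B) < f B → pair (shift p f) B < pair f B
  strict B lo hi lt = subst₂ _<_
    (trans (+-comm (f B * position (swap p B)) _) (sym (cong₂ (λ x y → x * position B + y * position (swap p B))
      (trans (shift-⊓ p f B lo) (m≥n⇒m⊓n≡n (<⇒≤ lt))) (trans (raise B lo hi) (m≤n⇒m⊔n≡n (<⇒≤ lt))))))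
    (+-comm (f (swap p B) * position (swap p B)) _)
    (exchange-< (position-swap p B lo hi) lt)

  pointwise-lower : ∀ B → lower p B ≡ false → higher p B ≡ true → pair (shift p f) B ≤ pair f B
  pointwise-lower B lo hi with f (swap p B) <? f B
  ... | yes lt = <⇒≤ (strict B lo hi lt)
  ... | no ¬lt = ≤-reflexive (cong₂ (λ x y → x * position B + y * position (swap p B))
      (trans (shift-⊓ p f B lo) (m≤n⇒m⊓n≡m (≮⇒≥ ¬lt))) (trans (raise B lo hi) (m≥n⇒m⊔n≡m (≮⇒≥ ¬lt))))

  fixed : ∀ B → lower p B ≡ higher p B → pair (shift p f) B ≤ pair f B
  fixed B eq with shift-pair p f B
  ... | inj₁ (e , e′) = ≤-reflexive (cong₂ (λ x y → x * position B + y * position (swap p B)) e e′)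
  ... | inj₂ (e , e′) rewrite e | e′ | swap-fixes p B eq = ≤-refl

  pair-swap : ∀ g B → pair g (swap p B) ≡ pair g B
  pair-swap g B rewrite swap-involutive p B = +-comm (g (swap p B) * position (swap p B)) _

  cases : ∀ {x y} B → lower p B ≡ x → higher p B ≡ y → pair (shift p f) B ≤ pair f B
  cases {true}  {true}  B lo hi = fixed B (trans lo (sym hi))
  cases {false} {false} B lo hi = fixed B (trans lo (sym hi))
  cases {false} {true}  B lo hi = pointwise-lower B lo hi
  cases {true}  {false} B lo hi = subst₂ _≤_ (pair-swap (shift p f) B) (pair-swap f B)
    (pointwise-lower (swap p B) (trans (lower-swap p B) hi) (trans (higher-swap p B) lo))

  pointwise : ∀ B → pair (shift p f) B ≤ pair f B
  pointwise B = cases B refl refl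

-- Stars

star : ∀ {n} → ℕ → Subset n → ℕ → Subset n → ℕ
star k C w A = if does (C ⊆? A) then layer k (λ _ → w) A else 0

star-∈ : ∀ {n k} {C A : Subset n} {w} → C ⊆ A → ∣ A ∣ ≡ k → star k C w A ≡ w
star-∈ {k = k} {C} {A} {w} C⊆A ∣A∣≡k with C ⊆? A
... | yes _   = layer-≡ k (λ _ → w) A ∣A∣≡k
... | no C⊈A = contradiction (λ {x} → C⊆A {x}) C⊈A

star-pos : ∀ {n k} {C A : Subset n} {w} → 0 < star k C w A → C ⊆ A × ∣ A ∣ ≡ k × star k C w A ≡ w
star-pos {k = k} {C} {A} pos with C ⊆? A | ∣ A ∣ ≡ᵇ k in eq
... | yes C⊆A | true = C⊆A , ≡ᵇ⇒≡ ∣ A ∣ k (subst T (sym eq) _) , refl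

-- Writing the size as `∣ C ∣ + d` keeps the induction free of subtraction from `k`: a point of `C`
-- leaves `d` alone, and a point outside it gives Pascal's rule.
∑-star-1 : ∀ {n} (C : Subset n) d → ∑ (star (∣ C ∣ + d) C 1) ≡ (n ∸ ∣ C ∣) choose d
∑-star-1 []         zero    = refl
∑-star-1 []         (suc d) = refl
∑-star-1 {suc n} (true  ∷ C) d = cong₂ _+_ (∑-0 n) (∑-star-1 C d)
∑-star-1 {suc n} (false ∷ C) zero =
  cong₂ _+_ (∑-star-1 C zero) (trans (∑-cong too-large) (∑-0 n))
  where
  too-large : ∀ A → star (∣ C ∣ + 0) (outside ∷ C) 1 (inside ∷ A) ≡ 0
  too-large A with star (∣ C ∣ + 0) (outside ∷ C) 1 (inside ∷ A) in eq
  ... | zero  = refl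
  ... | suc _ with C⊆A , size , _ ← star-pos {k = ∣ C ∣ + 0} {C = outside ∷ C} {A = inside ∷ A} (subst (0 <_) (sym eq) (s≤s z≤n)) =
    contradiction (trans size (+-identityʳ ∣ C ∣)) (<⇒≢ (s≤s (p⊆q⇒∣p∣≤∣q∣ (drop-∷-⊆ C⊆A))) ∘ sym)
∑-star-1 {suc n} (false ∷ C) (suc d) rewrite +-suc ∣ C ∣ d | +-∸-assoc 1 (∣p∣≤n C) = trans
  (cong₂ _+_ (trans (cong (λ k → ∑ (star k C 1)) (sym (+-suc ∣ C ∣ d))) (∑-star-1 C (suc d))) (∑-star-1 C d))
  (trans (+-comm ((n ∸ ∣ C ∣) choose suc d) _) (nCk+nC[k+1]≡[n+1]C[k+1] (n ∸ ∣ C ∣) d))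

-- Each of the `(n − c) choose (k − c)` members, where `c` is the size of the core, weighs
-- `fall n k` divided by their number. This is Φ = 1 for stars.
∑-star : ∀ {n k} (C : Subset n) → ∣ C ∣ ≤ k → k ≤ n → ∑ (star k C (levelWeight n k ∣ C ∣)) ≡ fall n k
∑-star {n} {k} C c≤k k≤n = begin
  ∑ (star k C w)                    ≡⟨ ∑-cong scale ⟩
  ∑ (λ A → w * star k C 1 A)        ≡⟨ ∑-*ˡ w (star k C 1) ⟩
  w * ∑ (star k C 1)                ≡⟨ *-comm w _ ⟩
  ∑ (star k C 1) * w                ≡⟨ cong (λ j → ∑ (star j C 1) * w) (sym (m+[n∸m]≡n c≤k)) ⟩
  ∑ (star (∣ C ∣ + (k ∸ ∣ C ∣)) C 1) * w ≡⟨ cong (_* w) (∑-star-1 C (k ∸ ∣ C ∣)) ⟩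
  ((n ∸ ∣ C ∣) choose (k ∸ ∣ C ∣)) * w   ≡⟨ C*levelWeight≡fall n k ∣ C ∣ c≤k k≤n ⟩
  fall n k                          ∎
  where
  open ≡-Reasoning
  w = levelWeight n k ∣ C ∣
  scale : ∀ A → star k C w A ≡ w * star k C 1 A
  scale A with does (C ⊆? A) | ∣ A ∣ ≡ᵇ k
  ... | true  | true  = sym (*-identityʳ w)
  ... | true  | false = sym (*-zeroʳ w)
  ... | false | _     = sym (*-zeroʳ w)

Trivial : ∀ {n} → (Subset n → ℕ) → Subset n → Set
Trivial f C = ∀ {A} → 0 < f A → C ⊆ A × f A ≤ suc ∣ C ∣

labelWeight≤star : ∀ {n k} {f : Subset n → ℕ} {C} → Labelling k f → k < n → ∣ C ∣ ≤ k → Trivial f C →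
  ∀ A → labelWeight n k (f A) ≤ star k C (levelWeight n k ∣ C ∣) A
labelWeight≤star {f = f} L k<n c≤k triv A with f A in eq
... | zero = z≤n
... | suc j with 0<fA ← subst (0 <_) (sym eq) (s≤s (z≤n {j})) with triv 0<fA
...   | C⊆A , le = ≤-trans
  (levelWeight-mono (s≤s⁻¹ (≤-trans (≤-reflexive (sym eq)) le)) c≤k k<n)
  (≤-reflexive (sym (star-∈ C⊆A (size L 0<fA))))

totalWeight-0 : ∀ {n k} {f : Subset n → ℕ} → (∀ A → f A ≡ 0) → totalWeight n k f ≡ 0
totalWeight-0 {n} {k} eq = trans (∑-cong (cong (labelWeight n k) ∘ eq)) (∑-0 n)

trivial-weight-≤ : ∀ {n k} {f : Subset n → ℕ} {C} → Labelling k f → k < n → Trivial f C →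
  totalWeight n k f ≤ fall n k
trivial-weight-≤ {n} {k} {f} {C} L k<n triv with ∣ C ∣ ≤? k
... | yes c≤k = ≤-trans (∑-mono (labelWeight≤star L k<n c≤k triv)) (≤-reflexive (∑-star C c≤k (<⇒≤ k<n)))
... | no c≰k  = ≤-trans (≤-reflexive (totalWeight-0 {n} {k} absent)) z≤n
  where
  absent : ∀ A → f A ≡ 0
  absent A with f A in eq
  ... | zero  = refl
  ... | suc j with 0<fA ← subst (0 <_) (sym eq) (s≤s (z≤n {j})) = contradiction
    (subst (∣ C ∣ ≤_) (size L 0<fA) (p⊆q⇒∣p∣≤∣q∣ (proj₁ (triv 0<fA)))) c≰k

label≤ : ∀ {n k} {f : Subset n → ℕ} → Labelling k f → ∀ {A} → 0 < f A → f A ≤ suc k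
label≤ L {A} pos = subst (λ s → _ ≤ suc s) (trans (cong ∣_∣ (∩-idem A)) (size L pos)) (meet L pos pos)

⊆-of-∣∩∣ : ∀ {n} (D A : Subset n) → ∣ D ∣ ≤ ∣ D ∩ A ∣ → D ⊆ A
⊆-of-∣∩∣ D A le {x} x∈D with x ∈? A
... | yes x∈A = x∈A
... | no x∉A  = contradiction le (<⇒≱ (p⊂q⇒∣p∣<∣q∣ (p∩q⊆p D A , x , x∈D , x∉A ∘ proj₂ ∘ x∈p∩q⁻ D A)))

∃-lookup : ∀ {n} (A : Subset n) → 0 < ∣ A ∣ → ∃[ j ] lookup A j ≡ true
∃-lookup (true  ∷ A) pos = zero , refl
∃-lookup (false ∷ A) pos with j , eq ← ∃-lookup A pos = suc j , eq

lookup-∩ : ∀ {n} (A B : Subset n) j → lookup (A ∩ B) j ≡ true → lookup A j ≡ true × lookup B j ≡ true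
lookup-∩ (true ∷ A) (true ∷ B) zero    eq = refl , refl
lookup-∩ (a ∷ A)    (b ∷ B)    (suc j) eq = lookup-∩ A B j eq

∣∩-remove∣ : ∀ {n} (A B : Subset n) j → lookup A j ≡ true → lookup B j ≡ true →
  suc ∣ A ∩ (B [ j ]≔ false) ∣ ≡ ∣ A ∩ B ∣
∣∩-remove∣ (true  ∷ A) (true ∷ B) zero refl refl = refl
∣∩-remove∣ (true  ∷ A) (true  ∷ B) (suc j) a b = cong suc (∣∩-remove∣ A B j a b)
∣∩-remove∣ (true  ∷ A) (false ∷ B) (suc j) a b = ∣∩-remove∣ A B j a b
∣∩-remove∣ (false ∷ A) (y     ∷ B) (suc j) a b = ∣∩-remove∣ A B j a b

lookup-remove : ∀ {n} (A : Subset n) i j → lookup (A [ j ]≔ false) i ≡ true → lookup A i ≡ true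
lookup-remove (a ∷ A) (suc i) zero    eq = eq
lookup-remove (a ∷ A) zero    (suc j) eq = eq
lookup-remove (a ∷ A) (suc i) (suc j) eq = lookup-remove A i j eq

to-front : ∀ {n} {f : Subset (suc n) → ℕ} → Shifted f → ∀ A j → lookup A j ≡ true →
  f (outside ∷ A) ≤ f (inside ∷ (A [ j ]≔ false))
to-front {f = f} sh A j eq =
  subst (λ b → f (outside ∷ A) ≤ f (b ∷ (A [ j ]≔ false))) eq (sh (here j) (outside ∷ A) refl eq)

-- Raising and lowering labels

raiseLabel : ℕ → ℕ
raiseLabel (suc (suc j)) = suc (suc (suc j))
raiseLabel _             = 0

lowerLabel : ℕ → ℕ
lowerLabel zero          = 0
lowerLabel (suc zero)    = 1
lowerLabel (suc (suc j)) = suc j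

raiseLabel-pos : ∀ {x} → 0 < raiseLabel x → 2 ≤ x × raiseLabel x ≡ suc x
raiseLabel-pos {suc (suc x)} _ = s≤s (s≤s z≤n) , refl

raiseLabel-mono : ∀ {x y} → x ≤ y → raiseLabel x ≤ raiseLabel y
raiseLabel-mono {zero}        _                   = z≤n
raiseLabel-mono {suc zero}    _                   = z≤n
raiseLabel-mono {suc (suc x)} (s≤s (s≤s x≤y))     = s≤s (s≤s (s≤s x≤y))

lowerLabel-pos : ∀ {x} → 0 < lowerLabel x → 0 < x
lowerLabel-pos {suc x} _ = s≤s z≤n

lowerLabel-pos⁻ : ∀ {x} → 0 < x → 0 < lowerLabel x
lowerLabel-pos⁻ {suc zero}    _ = s≤s z≤n
lowerLabel-pos⁻ {suc (suc x)} _ = s≤s z≤n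

lowerLabel-mono : ∀ {x y} → x ≤ y → lowerLabel x ≤ lowerLabel y
lowerLabel-mono {zero}        _                         = z≤n
lowerLabel-mono {suc zero}    {suc zero}    (s≤s z≤n)   = s≤s z≤n
lowerLabel-mono {suc zero}    {suc (suc y)} (s≤s z≤n)   = s≤s z≤n
lowerLabel-mono {suc (suc x)} (s≤s (s≤s x≤y))           = s≤s x≤y

lowerLabel-≤ : ∀ {x c} → x ≤ suc (suc c) → lowerLabel x ≤ suc c
lowerLabel-≤ {zero}        _        = z≤n
lowerLabel-≤ {suc zero}    _        = s≤s z≤n
lowerLabel-≤ {suc (suc x)} (s≤s le) = le

lowerLabel-≤⁻ : ∀ {x c} → lowerLabel x ≤ suc c → x ≤ suc (suc c)
lowerLabel-≤⁻ {zero}        _  = z≤n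
lowerLabel-≤⁻ {suc zero}    _  = s≤s z≤n
lowerLabel-≤⁻ {suc (suc x)} le = s≤s le

-- Shifted labellings

-- In avoid f the level-0 sets are dropped and every other level is raised by one; in link f
-- every positive level is lowered by one.
avoid link : ∀ {n} → (Subset (suc n) → ℕ) → Subset n → ℕ
avoid f A = raiseLabel (f (outside ∷ A))
link  f A = lowerLabel (f (inside ∷ A))

avoid-shifted : ∀ {n} {f : Subset (suc n) → ℕ} → Shifted f → Shifted (avoid f)
avoid-shifted sh p A lo hi = raiseLabel-mono (sh (there p) (outside ∷ A) lo hi)

link-shifted : ∀ {n} {f : Subset (suc n) → ℕ} → Shifted f → Shifted (link f)
link-shifted sh p A lo hi = lowerLabel-mono (sh (there p) (inside ∷ A) lo hi)

-- If A and B avoid the first point and share an element b, then B may be replaced by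
-- B − b + first point, so that |A ∩ B| exceeds the level of A.
avoid-labelling : ∀ {n k} {f : Subset (suc n) → ℕ} → Labelling k f → Shifted f → Labelling k (avoid f)
avoid-labelling {f = f} L sh = record { size = size′ ; meet = meet′ _ _ }
  where
  size′ : ∀ {A} → 0 < avoid f A → ∣ A ∣ ≡ _
  size′ pos = size L (≤-trans (n≤1+n 1) (proj₁ (raiseLabel-pos pos)))
  meet′ : ∀ A B → 0 < avoid f A → 0 < avoid f B → avoid f A ≤ suc ∣ A ∩ B ∣
  meet′ A B a b with raiseLabel-pos a | raiseLabel-pos b
  ... | 2≤fA , eq | 2≤fB , _
    with 0<fA ← ≤-trans (n≤1+n 1) 2≤fA | 0<fB ← ≤-trans (n≤1+n 1) 2≤fB
    with j , j∈ ← ∃-lookup (A ∩ B) (s≤s⁻¹ (≤-trans 2≤fA (meet L 0<fA 0<fB)))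
    with j∈A , j∈B ← lookup-∩ A B j j∈ = begin
    avoid f A                             ≡⟨ eq ⟩
    suc (f (outside ∷ A))                 ≤⟨ s≤s (meet L 0<fA (≤-trans 0<fB (to-front sh B j j∈B))) ⟩
    suc (suc ∣ A ∩ (B [ j ]≔ false) ∣)    ≡⟨ cong suc (∣∩-remove∣ A B j j∈A j∈B) ⟩
    suc ∣ A ∩ B ∣                         ∎
    where open ≤-Reasoning

-- All sets here share the first point, so deleting it costs one common point against one level;
-- level 0 stays, as it demands nothing.
link-labelling : ∀ {n k} {f : Subset (suc n) → ℕ} → Labelling (suc k) f → Labelling k (link f)
link-labelling L = record
  { size = λ pos → suc-injective (size L (lowerLabel-pos pos))
  ; meet = λ a b → lowerLabel-≤ (meet L (lowerLabel-pos a) (lowerLabel-pos b))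
  }

-- Twice the threshold k (k + 1)² / 2, and the same diminished by 2 k.
threshold slack : ℕ → ℕ
threshold k   = k * (suc k * suc k)
slack zero    = 0
slack (suc k) = suc k * (k * k + 4 * k + 2)

threshold≡ : ∀ k → threshold (suc k) ≡ slack (suc k) + 2 * suc k
threshold≡ = identity
  where
  identity : ∀ k → suc k * (suc (suc k) * suc (suc k)) ≡ suc k * (k * k + 4 * k + 2) + 2 * suc k
  identity = solve-∀

-- Passing from f to avoid f loses one point but gains one level, hence the correction term.
Large : (n k : ℕ) → (Subset n → ℕ) → Set
Large n k f = ∀ {A} → 0 < f A → threshold k ≤ 2 * n + 2 * (f A ∸ 2)

-- The second alternative says Φ ≤ slack k / (2 (n − 1)) after division by fall n k.
data Outcome (n k : ℕ) (f : Subset n → ℕ) : Set where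
  trivial : ∀ C → Trivial f C → Outcome n k f
  light   : 2 ≤ k → slack k ≤ 2 * (n ∸ 1) → 2 * (n ∸ 1) * totalWeight n k f ≤ slack k * fall n k →
            Outcome n k f

outcome-≤ : ∀ {n k f} → k < n → Labelling k f → Outcome n k f → totalWeight n k f ≤ fall n k
outcome-≤ k<n L (trivial C triv) = trivial-weight-≤ L k<n triv
outcome-≤ {suc zero}    (s≤s z≤n) L (light () _ _)
outcome-≤ {suc (suc n)} {k} k<n L (light _ slack≤ weight≤) =
  *-cancelˡ-≤ (2 * suc n) (≤-trans weight≤ (*-monoˡ-≤ (fall (suc (suc n)) k) slack≤))

slack⇒k<n : ∀ {n k} → 2 ≤ k → slack k ≤ 2 * n → k < n
slack⇒k<n {n} {suc (suc k)} (s≤s (s≤s z≤n)) le = *-cancelˡ-≤ 2 (≤-trans small le)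
  where
  identity : ∀ k → suc (suc k) * (suc k * suc k + 4 * suc k + 2) ≡ 2 * suc (suc (suc k)) + (k * k * k + 8 * (k * k) + 17 * k + 8)
  identity = solve-∀
  small : 2 * suc (suc (suc k)) ≤ slack (suc (suc k))
  small = ≤-trans (m≤m+n _ _) (≤-reflexive (sym (identity k)))

-- A level-0 set weighs `(suc k) !`, so this is a union bound for the weight of those that meet `D`:
-- each point of `D` accounts for the fraction `suc k / suc m` of `fall (suc m) (suc k)`.
∑-meeting : ∀ m k (D : Subset (suc m)) →
  suc m * ∑ (layer (suc k) (λ A → (suc k) ! * ∣ A ∩ D ∣)) ≡ ∣ D ∣ * suc k * fall (suc m) (suc k)
∑-meeting m k D = begin
  suc m * ∑ (layer (suc k) (λ A → (suc k) ! * ∣ A ∩ D ∣))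
    ≡⟨ cong (suc m *_) (∑-cong (layer-*ˡ (suc k) ((suc k) !) (λ A → ∣ A ∩ D ∣))) ⟩
  suc m * ∑ (λ A → (suc k) ! * layer (suc k) (λ A → ∣ A ∩ D ∣) A)
    ≡⟨ cong (suc m *_) (∑-*ˡ ((suc k) !) (layer (suc k) (λ A → ∣ A ∩ D ∣))) ⟩
  suc m * ((suc k) ! * ∑ (layer (suc k) (λ A → ∣ A ∩ D ∣)))
    ≡⟨ cong (λ s → suc m * ((suc k) ! * s)) (∑-layer-∩ k D) ⟩
  suc m * (suc k * k ! * (∣ D ∣ * (m choose k)))
    ≡⟨ regroup (suc m) (suc k) (k !) ∣ D ∣ (m choose k) ⟩
  ∣ D ∣ * suc k * (suc m * ((m choose k) * k !))
    ≡⟨ cong (λ x → ∣ D ∣ * suc k * (suc m * x)) (C*!≡fall m k) ⟩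
  ∣ D ∣ * suc k * fall (suc m) (suc k) ∎
  where
  open ≡-Reasoning
  regroup : ∀ m k f d c → m * (k * f * (d * c)) ≡ d * k * (m * (c * f))
  regroup = solve-∀

≤-from-+ : ∀ m o {n} → n ≡ m + o → m ≤ n
≤-from-+ m o eq = subst (m ≤_) (sym eq) (m≤m+n m o)

module _ {m k : ℕ} {f : Subset (suc (suc m)) → ℕ} (L : Labelling (suc (suc k)) f) (sh : Shifted f)
         (κ<1+m : suc (suc k) ≤ suc m) where
  private
    n κ fₙ fₘ : ℕ
    n  = suc (suc m)
    κ  = suc k
    fₙ = fall n (suc κ)
    fₘ = fall (suc m) (suc κ)

  avoiding-weight : ℕ
  avoiding-weight = ∑ (λ A → labelWeight n (suc κ) (f (outside ∷ A)))

  linking-weight : ℕ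
  linking-weight = ∑ (λ A → labelWeight n (suc κ) (f (inside ∷ A)))

  -- A set of positive level is paid for by its raised copy through `levelWeight-avoid`. A set of
  -- level 0 must meet `D`, whose level is positive, and is paid for by the common points.
  avoiding-pointwise : ∀ {D} → 2 ≤ f (inside ∷ D) → ∀ A →
    suc m * fₘ * labelWeight n (suc κ) (f (outside ∷ A)) ≤
    κ * fₙ * labelWeight (suc m) (suc κ) (avoid f A) +
    suc m * fₘ * layer (suc κ) (λ B → (suc κ) ! * ∣ B ∩ D ∣) A
  avoiding-pointwise {D} 2≤fD A with f (outside ∷ A) in eq
  ... | zero  = ≤-trans (≤-reflexive (*-zeroʳ (suc m * fₘ))) z≤n
  ... | suc zero = m≤n⇒m≤o+n (κ * fₙ * 0) (*-monoʳ-≤ (suc m * fₘ) (begin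
    (suc κ) !               ≡⟨ sym (*-identityʳ ((suc κ) !)) ⟩
    (suc κ) ! * 1           ≤⟨ *-monoʳ-≤ ((suc κ) !) meets ⟩
    (suc κ) ! * ∣ A ∩ D ∣   ≡⟨ sym (layer-≡ (suc κ) (λ B → (suc κ) ! * ∣ B ∩ D ∣) A (size L 0<fA)) ⟩
    layer (suc κ) (λ B → (suc κ) ! * ∣ B ∩ D ∣) A ∎))
    where
    open ≤-Reasoning
    0<fA : 0 < f (outside ∷ A)
    0<fA = subst (0 <_) (sym eq) (s≤s z≤n)
    meets : 1 ≤ ∣ A ∩ D ∣
    meets = s≤s⁻¹ (≤-trans 2≤fD (subst (λ B → f (inside ∷ D) ≤ suc ∣ B ∣) (∩-comm D A)
              (meet L (≤-trans (n≤1+n 1) 2≤fD) 0<fA)))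
  -- The raised label still obeys `label≤`, so the original level is at most `κ`, as
  -- `levelWeight-avoid` requires.
  ... | suc (suc i) = m≤n⇒m≤n+o _ (levelWeight-avoid (suc m) κ (suc i) (s≤s z≤n) (s≤s⁻¹ (s≤s⁻¹ level≤)) κ<1+m)
    where
    raised : raiseLabel (f (outside ∷ A)) ≡ suc (suc (suc i))
    raised = cong raiseLabel eq
    level≤ : suc (suc (suc i)) ≤ suc (suc κ)
    level≤ = subst (_≤ suc (suc κ)) raised
      (label≤ (avoid-labelling L sh) {A} (subst (0 <_) (sym raised) (s≤s z≤n)))

  -- In units of `fₙ / suc m`, the positive levels contribute at most `κ` by induction, and level 0
  -- at most `suc κ` for each of the `κ` points of `D`.
  avoiding-weight-≤ : totalWeight (suc m) (suc κ) (avoid f) ≤ fₘ → ∀ {D} → 2 ≤ f (inside ∷ D) →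
    suc m * avoiding-weight ≤ (κ + κ * suc κ) * fₙ
  avoiding-weight-≤ ih {D} 2≤fD = *-cancelˡ-≤ fₘ {{>-nonZero (fall-pos κ<1+m)}} (begin
    fₘ * (suc m * avoiding-weight)
      ≡⟨ regroup₁ fₘ (suc m) avoiding-weight ⟩
    suc m * fₘ * avoiding-weight
      ≡⟨ sym (∑-*ˡ (suc m * fₘ) avoiding) ⟩
    ∑ (λ A → suc m * fₘ * avoiding A)
      ≤⟨ ∑-mono {φ = λ A → suc m * fₘ * avoiding A} {ψ = λ A → κ * fₙ * raised A + suc m * fₘ * meeting A}
           (avoiding-pointwise 2≤fD) ⟩
    ∑ (λ A → κ * fₙ * raised A + suc m * fₘ * meeting A)
      ≡⟨ ∑-linear (κ * fₙ) raised (suc m * fₘ) meeting ⟩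
    κ * fₙ * totalWeight (suc m) (suc κ) (avoid f) + suc m * fₘ * ∑ meeting
      ≤⟨ +-mono-≤ (*-monoʳ-≤ (κ * fₙ) ih) (≤-reflexive (regroup₂ (suc m) fₘ (∑ meeting))) ⟩
    κ * fₙ * fₘ + fₘ * (suc m * ∑ meeting)
      ≡⟨ cong (λ x → κ * fₙ * fₘ + fₘ * x) (trans (∑-meeting m κ D) (cong (λ d → d * suc κ * fₘ) ∣D∣≡κ)) ⟩
    κ * fₙ * fₘ + fₘ * (κ * suc κ * fₘ)
      ≤⟨ +-monoʳ-≤ (κ * fₙ * fₘ) (*-monoʳ-≤ fₘ (*-monoʳ-≤ (κ * suc κ) (fall-monoˡ (n≤1+n (suc m)) (suc κ)))) ⟩
    κ * fₙ * fₘ + fₘ * (κ * suc κ * fₙ)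
      ≡⟨ regroup₃ κ fₙ fₘ ⟩
    fₘ * ((κ + κ * suc κ) * fₙ) ∎)
    where
    open ≤-Reasoning
    avoiding raised meeting : Subset (suc m) → ℕ
    avoiding A = labelWeight n (suc κ) (f (outside ∷ A))
    raised A = labelWeight (suc m) (suc κ) (avoid f A)
    meeting = layer (suc κ) (λ B → (suc κ) ! * ∣ B ∩ D ∣)
    ∣D∣≡κ : ∣ D ∣ ≡ κ
    ∣D∣≡κ = suc-injective (size L (≤-trans (n≤1+n 1) 2≤fD))
    regroup₁ : ∀ a b c → a * (b * c) ≡ b * a * c
    regroup₁ = solve-∀
    regroup₂ : ∀ a b c → a * b * c ≡ b * (a * c)
    regroup₂ = solve-∀
    regroup₃ : ∀ κ a b → κ * a * b + b * (κ * suc κ * a) ≡ b * ((κ + κ * suc κ) * a)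
    regroup₃ = solve-∀

  -- For positive levels this is the recursion of `levelWeight`; at level 0, which `lowerLabel`
  -- keeps, it comes from `suc κ ≤ n`.
  linking-weight-≤ : linking-weight ≤ n * totalWeight (suc m) κ (link f)
  linking-weight-≤ = ≤-trans
    (∑-mono {φ = λ A → labelWeight n (suc κ) (f (inside ∷ A))} {ψ = λ A → n * lowered A}
      (λ A → pointwise (f (inside ∷ A))))
    (≤-reflexive (∑-*ˡ n lowered))
    where
    lowered : Subset (suc m) → ℕ
    lowered A = labelWeight (suc m) κ (link f A)
    pointwise : ∀ x → labelWeight n (suc κ) x ≤ n * labelWeight (suc m) κ (lowerLabel x)
    pointwise zero          = z≤n
    pointwise (suc zero)    = *-monoˡ-≤ (κ !) (m≤n⇒m≤1+n κ<1+m)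
    pointwise (suc (suc i)) = ≤-refl

  -- The link is bounded with denominator `2 * m`. To reach `2 * suc m`, the two further copies are
  -- bounded by the plain estimate Φ ≤ 1, which costs the additional 2.
  linking-weight-light : 2 * m * totalWeight (suc m) κ (link f) ≤ slack κ * fall (suc m) κ →
    totalWeight (suc m) κ (link f) ≤ fall (suc m) κ →
    2 * (suc m) * linking-weight ≤ (slack κ + 2) * fₙ
  linking-weight-light le le′ = begin
    2 * suc m * linking-weight ≤⟨ *-monoʳ-≤ (2 * suc m) linking-weight-≤ ⟩
    2 * suc m * (n * W)        ≡⟨ regroup₁ m n W ⟩
    n * (2 * m * W + 2 * W)    ≤⟨ *-monoʳ-≤ n (+-mono-≤ le (*-monoʳ-≤ 2 le′)) ⟩
    n * (slack κ * fall (suc m) κ + 2 * fall (suc m) κ) ≡⟨ regroup₂ n (slack κ) (fall (suc m) κ) ⟩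
    (slack κ + 2) * fₙ ∎
    where
    open ≤-Reasoning
    W = totalWeight (suc m) κ (link f)
    regroup₁ : ∀ m n w → 2 * suc m * (n * w) ≡ n * (2 * m * w + 2 * w)
    regroup₁ = solve-∀
    regroup₂ : ∀ n s x → n * (s * x + 2 * x) ≡ (s + 2) * (n * x)
    regroup₂ = solve-∀

  -- If x ∈ C, moving a suitable element of E to the front yields a member of the link without x.
  link-core-empty : ∀ {C} → Trivial (link f) C → ∀ {E} → 0 < f (outside ∷ E) → ∣ C ∣ ≡ 0
  link-core-empty {C} triv {E} 0<fE = trans (cong ∣_∣ (Empty-unique {p = C} empty)) (∣⊥∣≡0 (suc m))
    where
    in-shifted : ∀ j → lookup E j ≡ true → C ⊆ (E [ j ]≔ false)
    in-shifted j j∈E = proj₁ (triv (lowerLabel-pos⁻ (≤-trans 0<fE (to-front sh E j j∈E))))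
    empty : Empty C
    empty (x , x∈C) with lookup E x in eq
    ... | true with () ← trans (sym ([]=⇒lookup (in-shifted x eq x∈C))) (lookup∘update x E false)
    ... | false with j , j∈E ← ∃-lookup E (subst (0 <_) (sym (size L 0<fE)) (s≤s z≤n))
      with () ← trans (sym eq) (lookup-remove E x j ([]=⇒lookup (in-shifted j j∈E x∈C)))

  -- The core of the link is empty, so members through the first point have level at most 1. Those
  -- of level 1 meet the `suc κ` points of `E`, which gives `suc κ * κ`; for level 0 all sets are
  -- counted, which gives `suc κ`.
  linking-weight-trivial : ∀ {C} → Trivial (link f) C → ∀ {E} → 0 < f (outside ∷ E) →
    suc m * linking-weight ≤ (suc κ * κ + suc κ) * fₙ
  linking-weight-trivial {C} triv {E} 0<fE = begin
    suc m * linking-weight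
      ≤⟨ *-monoʳ-≤ (suc m) (∑-mono {φ = λ A → labelWeight n (suc κ) (f (inside ∷ A))}
           {ψ = λ A → n * meeting A + (suc κ) ! * all A} pointwise) ⟩
    suc m * ∑ (λ A → n * meeting A + (suc κ) ! * all A)
      ≡⟨ cong (suc m *_) (∑-linear n meeting ((suc κ) !) all) ⟩
    suc m * (n * ∑ meeting + (suc κ) ! * ∑ all)
      ≡⟨ regroup₁ (suc m) n (∑ meeting) ((suc κ) !) (∑ all) ⟩
    n * (suc m * ∑ meeting) + suc m * ((suc κ) ! * ∑ all)
      ≡⟨ cong₂ (λ x y → n * x + suc m * ((suc κ) ! * y))
           (trans (∑-meeting m k E) (cong (λ d → d * κ * fall (suc m) κ) (size L 0<fE))) (∑-layer-1 (suc m) κ) ⟩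
    n * (suc κ * κ * fall (suc m) κ) + suc m * (suc κ * κ ! * (suc m choose κ))
      ≡⟨ cong (n * (suc κ * κ * fall (suc m) κ) +_) (regroup₂ (suc m) (suc κ) (κ !) (suc m choose κ)) ⟩
    n * (suc κ * κ * fall (suc m) κ) + suc m * (suc κ * ((suc m choose κ) * κ !))
      ≡⟨ cong (λ x → n * (suc κ * κ * fall (suc m) κ) + suc m * (suc κ * x)) (C*!≡fall (suc m) κ) ⟩
    n * (suc κ * κ * fall (suc m) κ) + suc m * (suc κ * fall (suc m) κ)
      ≤⟨ +-monoʳ-≤ (n * (suc κ * κ * fall (suc m) κ)) (*-monoˡ-≤ _ (n≤1+n (suc m))) ⟩
    n * (suc κ * κ * fall (suc m) κ) + n * (suc κ * fall (suc m) κ)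
      ≡⟨ regroup₃ n (suc κ * κ) (suc κ) (fall (suc m) κ) ⟩
    (suc κ * κ + suc κ) * fₙ ∎
    where
    open ≤-Reasoning
    meeting all : Subset (suc m) → ℕ
    all = layer κ (λ _ → 1)
    meeting = layer κ (λ A → κ ! * ∣ A ∩ E ∣)
    link≤1 : ∀ {A} → 0 < f (inside ∷ A) → f (inside ∷ A) ≤ 2
    link≤1 {A} pos = lowerLabel-≤⁻
      (subst (λ c → link f A ≤ suc c) (link-core-empty triv 0<fE) (proj₂ (triv (lowerLabel-pos⁻ pos))))
    pointwise : ∀ A → labelWeight n (suc κ) (f (inside ∷ A)) ≤ n * meeting A + (suc κ) ! * all A
    pointwise A with f (inside ∷ A) in eq
    ... | zero     = z≤n
    ... | suc zero = m≤n⇒m≤o+n (n * meeting A) (≤-reflexive (sym (trans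
      (cong ((suc κ) ! *_) (layer-≡ κ (λ _ → 1) A (suc-injective (size L (subst (0 <_) (sym eq) (s≤s z≤n))))))
      (*-identityʳ ((suc κ) !)))))
    ... | suc (suc zero) = m≤n⇒m≤n+o _ (*-monoʳ-≤ n (begin
      κ !                  ≡⟨ sym (*-identityʳ (κ !)) ⟩
      κ ! * 1              ≤⟨ *-monoʳ-≤ (κ !) (s≤s⁻¹ (subst (_≤ suc ∣ A ∩ E ∣) eq (meet L 0<fA 0<fE))) ⟩
      κ ! * ∣ A ∩ E ∣      ≡⟨ sym (layer-≡ κ (λ A → κ ! * ∣ A ∩ E ∣) A (suc-injective (size L 0<fA))) ⟩
      meeting A            ∎))
      where
      0<fA : 0 < f (inside ∷ A)
      0<fA = subst (0 <_) (sym eq) (s≤s z≤n)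
    ... | suc (suc (suc i)) = contradiction
      (subst (_≤ 2) eq (link≤1 (subst (0 <_) (sym eq) (s≤s z≤n)))) (λ { (s≤s (s≤s ())) })
    regroup₁ : ∀ m n x f y → m * (n * x + f * y) ≡ n * (m * x) + m * (f * y)
    regroup₁ = solve-∀
    regroup₂ : ∀ m s f c → m * (s * f * c) ≡ m * (s * (c * f))
    regroup₂ = solve-∀
    regroup₃ : ∀ n a b x → n * (a * x) + n * (b * x) ≡ (a + b) * (n * x)
    regroup₃ = solve-∀

  front-witness : ∀ {D} → 2 ≤ f D → ∃[ D′ ] 2 ≤ f (inside ∷ D′)
  front-witness {true  ∷ D} 2≤fD = D , 2≤fD
  front-witness {false ∷ D} 2≤fD
    with j , j∈D ← ∃-lookup D (subst (0 <_) (sym (size L (≤-trans (n≤1+n 1) 2≤fD))) (s≤s z≤n)) =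
    D [ j ]≔ false , ≤-trans 2≤fD (to-front sh D j j∈D)

  -- If no member avoids the first point, a core of the link extends by that point, and a light link
  -- stays light. If some member `E` avoids it, the bounds for the avoiding and the linking members
  -- are added, and their sum stays below `slack (suc κ)`.
  outcome-step : slack (suc κ) ≤ 2 * suc m → ∃[ D ] 2 ≤ f D →
    totalWeight (suc m) (suc κ) (avoid f) ≤ fₘ → Outcome (suc m) κ (link f) → Outcome n (suc κ) f
  outcome-step slack≤ (D , 2≤fD) ih-avoid ih-link
    with D′ , 2≤fD′ ← front-witness 2≤fD
    with anySubset? (λ E → 1 ≤? f (outside ∷ E)) | ih-link
  ... | no ¬E | trivial C triv = trivial (inside ∷ C) cone
    where
    cone : Trivial f (inside ∷ C)
    cone {false ∷ A} pos = contradiction (A , pos) ¬E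
    cone {true  ∷ A} pos with triv {A} (lowerLabel-pos⁻ pos)
    ... | C⊆A , le = in⊆in C⊆A , lowerLabel-≤⁻ le
  ... | no ¬E | light _ _ w≤ = light (s≤s (s≤s z≤n)) slack≤ (begin
    2 * suc m * (avoiding-weight + linking-weight)
      ≡⟨ cong (λ x → 2 * suc m * (x + linking-weight)) no-avoiding ⟩
    2 * suc m * linking-weight
      ≤⟨ linking-weight-light w≤ (outcome-≤ κ<1+m (link-labelling L) ih-link) ⟩
    (slack κ + 2) * fₙ
      ≤⟨ *-monoˡ-≤ fₙ (≤-from-+ (slack κ + 2) (3 * (k * k) + 13 * k + 10) (identity k)) ⟩
    slack (suc κ) * fₙ ∎)
    where
    open ≤-Reasoning
    no-avoiding : avoiding-weight ≡ 0
    no-avoiding = trans (∑-cong (λ A → cong (labelWeight n (suc κ)) (absent′ A))) (∑-0 (suc m))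
      where
      absent′ : ∀ A → f (outside ∷ A) ≡ 0
      absent′ A = n≤0⇒n≡0 (≮⇒≥ (λ pos → ¬E (A , pos)))
    identity : ∀ k → suc (suc k) * (suc k * suc k + 4 * suc k + 2) ≡
                     (suc k * (k * k + 4 * k + 2) + 2) + (3 * (k * k) + 13 * k + 10)
    identity = solve-∀
  ... | yes (E , 0<fE) | trivial C triv = light (s≤s (s≤s z≤n)) slack≤ (begin
    2 * suc m * (avoiding-weight + linking-weight)
      ≡⟨ regroup (suc m) avoiding-weight linking-weight ⟩
    2 * (suc m * avoiding-weight + suc m * linking-weight)
      ≤⟨ *-monoʳ-≤ 2 (+-mono-≤ (avoiding-weight-≤ ih-avoid 2≤fD′) (linking-weight-trivial triv 0<fE)) ⟩
    2 * ((κ + κ * suc κ) * fₙ + (suc κ * κ + suc κ) * fₙ)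
      ≡⟨ factor (κ + κ * suc κ) (suc κ * κ + suc κ) fₙ ⟩
    2 * ((κ + κ * suc κ) + (suc κ * κ + suc κ)) * fₙ
      -- For `k = 0`, that is for sets of size 2, both sides of this comparison have the coefficient
      -- 14.
      ≤⟨ *-monoˡ-≤ fₙ (≤-from-+ (2 * ((κ + κ * suc κ) + (suc κ * κ + suc κ))) (k * k * k + 4 * (k * k) + 3 * k) (identity k)) ⟩
    slack (suc κ) * fₙ ∎)
    where
    open ≤-Reasoning
    regroup : ∀ m a b → 2 * m * (a + b) ≡ 2 * (m * a + m * b)
    regroup = solve-∀
    factor : ∀ a b x → 2 * (a * x + b * x) ≡ 2 * (a + b) * x
    factor = solve-∀
    identity : ∀ k → suc (suc k) * (suc k * suc k + 4 * suc k + 2) ≡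
      2 * ((suc k + suc k * suc (suc k)) + (suc (suc k) * suc k + suc (suc k))) + (k * k * k + 4 * (k * k) + 3 * k)
    identity = solve-∀
  ... | yes (E , 0<fE) | light _ _ w≤ = light (s≤s (s≤s z≤n)) slack≤ (begin
    2 * suc m * (avoiding-weight + linking-weight)
      ≡⟨ regroup (suc m) avoiding-weight linking-weight ⟩
    2 * (suc m * avoiding-weight) + 2 * suc m * linking-weight
      ≤⟨ +-mono-≤ (*-monoʳ-≤ 2 (avoiding-weight-≤ ih-avoid 2≤fD′))
           (linking-weight-light w≤ (outcome-≤ κ<1+m (link-labelling L) ih-link)) ⟩
    2 * ((κ + κ * suc κ) * fₙ) + (slack κ + 2) * fₙ
      ≡⟨ factor (κ + κ * suc κ) (slack κ + 2) fₙ ⟩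
    (2 * (κ + κ * suc κ) + (slack κ + 2)) * fₙ
      ≤⟨ *-monoˡ-≤ fₙ (≤-from-+ (2 * (κ + κ * suc κ) + (slack κ + 2)) (k * k + 5 * k + 4) (identity k)) ⟩
    slack (suc κ) * fₙ ∎)
    where
    open ≤-Reasoning
    regroup : ∀ m a b → 2 * m * (a + b) ≡ 2 * (m * a) + 2 * m * b
    regroup = solve-∀
    factor : ∀ a b x → 2 * (a * x) + b * x ≡ (2 * a + b) * x
    factor = solve-∀
    identity : ∀ k → suc (suc k) * (suc k * suc k + 4 * suc k + 2) ≡
      (2 * (suc k + suc k * suc (suc k)) + (suc k * (k * k + 4 * k + 2) + 2)) + (k * k + 5 * k + 4)
    identity = solve-∀

-- The correction term is at most `2 * k`. Together with the 2 for the lost point it makes up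
-- exactly the difference between `threshold` and `slack`.
slack-from-large : ∀ {n k x} → x ≤ suc (suc k) → threshold (suc k) ≤ 2 * suc n + 2 * (x ∸ 2) →
  slack (suc k) ≤ 2 * n
slack-from-large {n} {k} {x} x≤ large = +-cancelʳ-≤ (2 * suc k) _ _ (begin
  slack (suc k) + 2 * suc k ≡⟨ sym (threshold≡ k) ⟩
  threshold (suc k)         ≤⟨ large ⟩
  2 * suc n + 2 * (x ∸ 2)   ≤⟨ +-monoʳ-≤ (2 * suc n) (*-monoʳ-≤ 2 (∸-monoˡ-≤ 2 x≤)) ⟩
  2 * suc n + 2 * k         ≡⟨ identity n k ⟩
  2 * n + 2 * suc k         ∎)
  where
  open ≤-Reasoning
  identity : ∀ n k → 2 * suc n + 2 * k ≡ 2 * n + 2 * suc k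
  identity = solve-∀

threshold≤slack : ∀ k → threshold k ≤ slack (suc k)
threshold≤slack k = ≤-from-+ (threshold k) (3 * (k * k) + 5 * k + 2) (identity k)
  where
  identity : ∀ k → suc k * (k * k + 4 * k + 2) ≡ k * (suc k * suc k) + (3 * (k * k) + 5 * k + 2)
  identity = solve-∀

-- Induction on `n`. Only a member of positive level with `k ≥ 2` needs the deletion of the first
-- point: `avoid f` keeps `k`, `link f` decreases it.
shifted-outcome : ∀ n k {f : Subset n → ℕ} → Labelling k f → Shifted f → Large n k f → Outcome n k f
shifted-outcome n k {f} L sh large with anySubset? (λ D → 2 ≤? f D)
... | no ¬D = trivial ⊥ λ {A} _ →
  ⊥⊆ , ≤-trans (≮⇒≥ (λ 2≤fA → ¬D (A , 2≤fA))) (s≤s z≤n)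
shifted-outcome n zero L sh large | yes (D , 2≤fD) =
  contradiction (≤-trans 2≤fD (label≤ L (≤-trans (n≤1+n 1) 2≤fD))) (<-irrefl refl)
-- A singleton of level 1 meets every member, so it is the core.
shifted-outcome n (suc zero) L sh large | yes (D , 2≤fD) = trivial D λ {A} pos →
  ⊆-of-∣∩∣ D A (≤-trans (≤-reflexive ∣D∣≡1) (s≤s⁻¹ (≤-trans 2≤fD (meet L 0<fD pos)))) ,
  ≤-trans (label≤ L pos) (≤-reflexive (cong suc (sym ∣D∣≡1)))
  where
  0<fD = ≤-trans (n≤1+n 1) 2≤fD
  ∣D∣≡1 = size L 0<fD
shifted-outcome zero (suc (suc k)) L sh large | yes ([] , 2≤fD) with () ← size L (≤-trans (n≤1+n 1) 2≤fD)
shifted-outcome (suc zero) (suc (suc k)) L sh large | yes (D , 2≤fD) =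
  contradiction (subst (_≤ 1) (size L (≤-trans (n≤1+n 1) 2≤fD)) (∣p∣≤n D)) λ { (s≤s ()) }
shifted-outcome (suc (suc m)) (suc (suc k)) {f} L sh large | yes (D , 2≤fD) =
  outcome-step L sh (<⇒≤ k<m) slack≤ (D , 2≤fD)
    (outcome-≤ k<m (avoid-labelling L sh)
      (shifted-outcome (suc m) (suc (suc k)) (avoid-labelling L sh) (avoid-shifted sh) avoid-large))
    (shifted-outcome (suc m) (suc k) (link-labelling L) (link-shifted sh) link-large)
  where
  0<fD : 0 < f D
  0<fD = ≤-trans (n≤1+n 1) 2≤fD
  slack≤ : slack (suc (suc k)) ≤ 2 * suc m
  slack≤ = slack-from-large {suc m} {suc k} (label≤ L 0<fD) (large 0<fD)
  k<m : suc (suc k) < suc m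
  k<m = slack⇒k<n (s≤s (s≤s z≤n)) slack≤
  avoid-large : Large (suc m) (suc (suc k)) (avoid f)
  avoid-large {A} pos with f (outside ∷ A) in eq
  ... | suc (suc i) = ≤-trans (large {outside ∷ A} (subst (0 <_) (sym eq) (s≤s z≤n)))
    (≤-reflexive (trans (cong (λ x → 2 * suc (suc m) + 2 * (x ∸ 2)) eq) (identity (suc m) i)))
    where
    identity : ∀ m i → 2 * suc m + 2 * i ≡ 2 * m + 2 * suc i
    identity = solve-∀
  -- For sets smaller by one the threshold lies below `slack`, so no correction term is needed here.
  link-large : Large (suc m) (suc k) (link f)
  link-large pos = m≤n⇒m≤n+o _ (≤-trans (threshold≤slack (suc k)) slack≤)

-- Undoing shifts of full stars

∣∪∣≤ : ∀ {n} (A B : Subset n) → ∣ A ∪ B ∣ ≤ ∣ A ∣ + ∣ B ∣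
∣∪∣≤ []          []          = z≤n
∣∪∣≤ (true  ∷ A) (true  ∷ B) = s≤s (≤-trans (∣∪∣≤ A B) (+-monoʳ-≤ ∣ A ∣ (n≤1+n ∣ B ∣)))
∣∪∣≤ (true  ∷ A) (false ∷ B) = s≤s (∣∪∣≤ A B)
∣∪∣≤ (false ∷ A) (true  ∷ B) = ≤-trans (s≤s (∣∪∣≤ A B)) (≤-reflexive (sym (+-suc ∣ A ∣ ∣ B ∣)))
∣∪∣≤ (false ∷ A) (false ∷ B) = ∣∪∣≤ A B

-- The `d` new points are taken greedily from outside `U`, where at least `d` are available.
extend : ∀ {n} {C U : Subset n} d → C ⊆ U → d + ∣ U ∣ ≤ n → ∃[ R ] (∣ R ∣ ≡ ∣ C ∣ + d × R ∩ U ≡ C)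
extend {C = []} {[]} zero C⊆U le = [] , refl , refl
extend {C = true ∷ C} {true ∷ U} d C⊆U le
  with R , size , eq ← extend d (drop-∷-⊆ C⊆U) (s≤s⁻¹ (≤-trans (≤-reflexive (sym (+-suc d ∣ U ∣))) le)) =
  true ∷ R , cong suc size , cong (true ∷_) eq
extend {C = true ∷ C} {false ∷ U} d C⊆U le with () ← C⊆U Vec.here
extend {C = false ∷ C} {true ∷ U} d C⊆U le
  with R , size , eq ← extend d (drop-∷-⊆ C⊆U) (s≤s⁻¹ (≤-trans (≤-reflexive (sym (+-suc d ∣ U ∣))) le)) =
  false ∷ R , size , cong (false ∷_) eq
extend {C = false ∷ C} {false ∷ U} zero C⊆U le
  with R , size , eq ← extend zero (drop-∷-⊆ C⊆U) (∣p∣≤n U) =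
  false ∷ R , size , cong (false ∷_) eq
extend {C = false ∷ C} {false ∷ U} (suc d) C⊆U le
  with R , size , eq ← extend d (drop-∷-⊆ C⊆U) (s≤s⁻¹ le) =
  true ∷ R , trans (cong suc size) (sym (+-suc ∣ C ∣ d)) , cong (false ∷_) eq

extend-⊇ : ∀ {n k} {C U : Subset n} → C ⊆ U → ∣ C ∣ ≤ k → (k ∸ ∣ C ∣) + ∣ U ∣ ≤ n →
  ∃[ R ] (∣ R ∣ ≡ k × C ⊆ R × R ∩ U ≡ C)
extend-⊇ {k = k} {C} {U} C⊆U c≤k le with R , size , eq ← extend (k ∸ ∣ C ∣) C⊆U le =
  R , trans size (m+[n∸m]≡n c≤k) , (λ x∈C → p∩q⊆p R U (subst (_ ∈_) (sym eq) x∈C)) , eq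

lower-∩ : ∀ {n} (p : Swap n) A B → lower p (A ∩ B) ≡ lower p A ∧ lower p B
lower-∩ (here j)  (a ∷ A) (b ∷ B) = refl
lower-∩ (there p) (a ∷ A) (b ∷ B) = lower-∩ p A B

higher-∩ : ∀ {n} (p : Swap n) A B → higher p (A ∩ B) ≡ higher p A ∧ higher p B
higher-∩ p A B = begin
  higher p (A ∩ B)                          ≡⟨ sym (lower-swap p (A ∩ B)) ⟩
  lower p (swap p (A ∩ B))                  ≡⟨ cong (lower p) (sym (swap-∩ p A B)) ⟩
  lower p (swap p A ∩ swap p B)             ≡⟨ lower-∩ p (swap p A) (swap p B) ⟩
  lower p (swap p A) ∧ lower p (swap p B)   ≡⟨ cong₂ _∧_ (lower-swap p A) (lower-swap p B) ⟩
  higher p A ∧ higher p B                   ∎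
  where open ≡-Reasoning

⊆⇒∩≡ : ∀ {n} {C A : Subset n} → C ⊆ A → C ∩ A ≡ C
⊆⇒∩≡ {C = C} {A} C⊆A = ⊆-antisym (p∩q⊆p C A) (λ x∈C → x∈p∩q⁺ (x∈C , C⊆A x∈C))

∧-true⁻ʳ : ∀ {a b} → a ∧ b ≡ true → b ≡ true
∧-true⁻ʳ {true} eq = eq

lower-⊆ : ∀ {n} (p : Swap n) {C A} → C ⊆ A → lower p C ≡ true → lower p A ≡ true
lower-⊆ p {C} {A} C⊆A eq = ∧-true⁻ʳ {lower p C}
  (trans (sym (lower-∩ p C A)) (trans (cong (lower p) (⊆⇒∩≡ C⊆A)) eq))

higher-⊆ : ∀ {n} (p : Swap n) {C A} → C ⊆ A → higher p C ≡ true → higher p A ≡ true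
higher-⊆ p {C} {A} C⊆A eq = ∧-true⁻ʳ {higher p C}
  (trans (sym (higher-∩ p C A)) (trans (cong (higher p) (⊆⇒∩≡ C⊆A)) eq))

swap-⊆ : ∀ {n} (p : Swap n) {C A} → C ⊆ A → swap p C ⊆ swap p A
swap-⊆ p {C} {A} C⊆A = ⊆-of-∣∩∣ (swap p C) (swap p A) (≤-reflexive (begin
  ∣ swap p C ∣              ≡⟨ ∣swap∣ p C ⟩
  ∣ C ∣                     ≡⟨ cong ∣_∣ (sym (⊆⇒∩≡ C⊆A)) ⟩
  ∣ C ∩ A ∣                 ≡⟨ sym (∣swap∩swap∣ p C A) ⟩
  ∣ swap p C ∩ swap p A ∣   ∎))
  where open ≡-Reasoning

lower⇒pos : ∀ {n} (p : Swap n) A → lower p A ≡ true → 0 < ∣ A ∣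
lower⇒pos (here j)  (true  ∷ A) eq = s≤s z≤n
lower⇒pos (there p) (true  ∷ A) eq = s≤s z≤n
lower⇒pos (there p) (false ∷ A) eq = lower⇒pos p A eq

-- The swap takes the common lower point out of `B` and replaces it by the higher one, which `A`
-- lacks.
∩-swap-< : ∀ {n} (p : Swap n) A B → lower p A ≡ true → lower p B ≡ true →
  higher p A ≡ false → higher p B ≡ false → ∣ A ∩ swap p B ∣ < ∣ A ∩ B ∣
∩-swap-< (here j) (true ∷ A) (true ∷ B) refl refl a b rewrite b = s≤s (≤-reflexive (update A B j a))
  where
  update : ∀ {n} (A B : Subset n) j → lookup A j ≡ false → ∣ A ∩ (B [ j ]≔ true) ∣ ≡ ∣ A ∩ B ∣
  update (false ∷ A) (b     ∷ B) zero    eq = refl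
  update (true  ∷ A) (true  ∷ B) (suc j) eq = cong suc (update A B j eq)
  update (true  ∷ A) (false ∷ B) (suc j) eq = update A B j eq
  update (false ∷ A) (b     ∷ B) (suc j) eq = update A B j eq
∩-swap-< (there p) (true  ∷ A) (true  ∷ B) a b c d = s≤s (∩-swap-< p A B a b c d)
∩-swap-< (there p) (true  ∷ A) (false ∷ B) a b c d = ∩-swap-< p A B a b c d
∩-swap-< (there p) (false ∷ A) (y     ∷ B) a b c d = ∩-swap-< p A B a b c d

star-∉ : ∀ {n k} {C A : Subset n} {w} → C ⊈ A → star k C w A ≡ 0
star-∉ {C = C} {A} C⊈A with C ⊆? A
... | yes C⊆A = contradiction (λ {x} → C⊆A {x}) C⊈A
... | no _    = refl

pos-or-0 : ∀ x → 0 < x ⊎ x ≡ 0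
pos-or-0 zero    = inj₂ refl
pos-or-0 (suc x) = inj₁ (s≤s z≤n)

star-≡ : ∀ {n k} {C C′ A A′ : Subset n} {w} → (C ⊆ A → C′ ⊆ A′) → (C′ ⊆ A′ → C ⊆ A) → ∣ A ∣ ≡ ∣ A′ ∣ →
  star k C w A ≡ star k C′ w A′
star-≡ {k = k} {C} {C′} {A} {A′} to from eq rewrite eq with C ⊆? A | C′ ⊆? A′
... | yes _   | yes _    = refl
... | no _    | no _     = refl
... | yes C⊆A | no C⊈A′ = contradiction (λ {x} → to C⊆A {x}) C⊈A′
... | no C⊈A | yes C⊆A′ = contradiction (λ {x} → from C⊆A′ {x}) C⊈A

star-swap : ∀ {n k} (p : Swap n) (C A : Subset n) {w} → star k (swap p C) w A ≡ star k C w (swap p A)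
star-swap {k = k} p C A {w} = star-≡ {k = k} {w = w}
  (λ le → subst (_⊆ swap p A) (swap-involutive p C) (swap-⊆ p le))
  (λ le → subst (swap p C ⊆_) (swap-involutive p A) (swap-⊆ p le))
  (sym (∣swap∣ p A))

FullStar : ∀ {n} → ℕ → (Subset n → ℕ) → Set
FullStar {n} k f = Σ (Subset n) λ C → ∣ C ∣ ≤ k × (∀ A → f A ≡ star k C (suc ∣ C ∣) A)

module _ {n k : ℕ} (p : Swap n) {f : Subset n → ℕ} (L : Labelling k f) (2k≤n : 2 * k ≤ n) (3k≤1+n : 3 * k ≤ suc n)
         {C : Subset n} (c≤k : ∣ C ∣ ≤ k) (full : ∀ A → shift p f A ≡ star k C (suc ∣ C ∣) A) where
  private
    g : Subset n → ℕ
    g = shift p f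

    g-pos : ∀ {A} → 0 < g A → C ⊆ A × ∣ A ∣ ≡ k × g A ≡ suc ∣ C ∣
    g-pos {A} pos with star-pos {k = k} {C} {A} (subst (0 <_) (full A) pos)
    ... | C⊆A , size , eq = C⊆A , size , trans (full A) eq

    g-∈ : ∀ {A} → C ⊆ A → ∣ A ∣ ≡ k → g A ≡ suc ∣ C ∣
    g-∈ {A} C⊆A size = trans (full A) (star-∈ C⊆A size)

    g-∉ : ∀ {A} → C ⊈ A → g A ≡ 0
    g-∉ {A} C⊈A = trans (full A) (star-∉ {k = k} {C} {A} C⊈A)

  -- The star is then invariant under the swap, so exchanging the two labels of a pair changes
  -- nothing.
  unshift-fixed : lower p C ≡ higher p C → ∀ A → f A ≡ g A
  unshift-fixed eq A with shift-pair p f A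
  ... | inj₁ (e , _)  = sym e
  ... | inj₂ (e , e′) = begin
    f A                               ≡⟨ sym e′ ⟩
    g (swap p A)                      ≡⟨ full (swap p A) ⟩
    star k C (suc ∣ C ∣) (swap p A)   ≡⟨ sym (star-swap {k = k} p C A) ⟩
    star k (swap p C) (suc ∣ C ∣) A   ≡⟨ cong (λ S → star k S (suc ∣ C ∣) A) (swap-fixes p C eq) ⟩
    star k C (suc ∣ C ∣) A            ≡⟨ sym (full A) ⟩
    g A                               ∎
    where open ≡-Reasoning

  -- The label of a set without the lower point is a minimum. If it is positive, the swapped set is
  -- in the star as well, although it lacks the higher point and hence part of `C`.
  not-raised : lower p C ≡ false → higher p C ≡ true → ∀ {A} → C ⊆ A → ∣ A ∣ ≡ k → lower p A ≢ false
  not-raised lo hi {A} C⊆A size lA = contradiction (trans (sym lA)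
    (trans (sym (higher-swap p A)) (higher-⊆ p (proj₁ (g-pos swapped-pos)) hi))) λ ()
    where
    min-pos : 0 < f A ⊓ f (swap p A)
    min-pos = subst (0 <_) (trans (sym (g-∈ C⊆A size)) (shift-⊓ p f A lA)) (s≤s z≤n)
    swapped-pos : 0 < g (swap p A)
    swapped-pos with shift-pair p f A
    ... | inj₁ (_ , e) = subst (0 <_) (sym e) (≤-trans min-pos (m⊓n≤n (f A) _))
    ... | inj₂ (_ , e) = subst (0 <_) (sym e) (≤-trans min-pos (m⊓n≤m _ _))

  -- This case is void: since `swap p C` contains the lower point, a `k`-set `R` with
  -- `R ∩ (C ∪ swap p C) ≡ C` misses that point, against `not-raised`.
  unshift-raised : lower p C ≡ false → higher p C ≡ true → ∀ A → f A ≡ g A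
  unshift-raised lo hi = contradiction (avoids (lower p R) refl) (not-raised lo hi C⊆R (proj₁ (proj₂ extension)))
    where
    room : k ∸ ∣ C ∣ + ∣ C ∪ swap p C ∣ ≤ n
    room = begin
      k ∸ ∣ C ∣ + ∣ C ∪ swap p C ∣        ≤⟨ +-monoʳ-≤ (k ∸ ∣ C ∣) (∣∪∣≤ C (swap p C)) ⟩
      k ∸ ∣ C ∣ + (∣ C ∣ + ∣ swap p C ∣)  ≡⟨ cong (λ c → k ∸ ∣ C ∣ + (∣ C ∣ + c)) (∣swap∣ p C) ⟩
      k ∸ ∣ C ∣ + (∣ C ∣ + ∣ C ∣)         ≡⟨ sym (+-assoc (k ∸ ∣ C ∣) ∣ C ∣ ∣ C ∣) ⟩
      k ∸ ∣ C ∣ + ∣ C ∣ + ∣ C ∣           ≡⟨ cong (_+ ∣ C ∣) (m∸n+n≡m c≤k) ⟩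
      k + ∣ C ∣                           ≤⟨ +-monoʳ-≤ k (≤-trans c≤k (m≤m+n k 0)) ⟩
      2 * k                               ≤⟨ 2k≤n ⟩
      n                                   ∎
      where open ≤-Reasoning
    extension : ∃[ R ] (∣ R ∣ ≡ k × C ⊆ R × R ∩ (C ∪ swap p C) ≡ C)
    extension = extend-⊇ {k = k} {C} {C ∪ swap p C} (p⊆p∪q (swap p C)) c≤k room
    R = proj₁ extension
    C⊆R : C ⊆ R
    C⊆R = proj₁ (proj₂ (proj₂ extension))
    U∋lower : lower p (C ∪ swap p C) ≡ true
    U∋lower = lower-⊆ p (q⊆p∪q C (swap p C)) (trans (lower-swap p C) hi)
    avoids : ∀ b → lower p R ≡ b → lower p R ≡ false
    avoids false e = e
    avoids true  e = contradiction (trans (sym lo) (trans (cong (lower p) (sym (proj₂ (proj₂ (proj₂ extension)))))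
                       (trans (lower-∩ p R _) (cong₂ _∧_ e U∋lower)))) λ ()

  module _ (lo : lower p C ≡ true) (hi : higher p C ≡ false) where
    ∌lower⇒0 : ∀ {A} → lower p A ≡ false → g A ≡ 0
    ∌lower⇒0 lA = g-∉ λ C⊆A → contradiction (trans (sym lA) (lower-⊆ p C⊆A lo)) λ ()

    -- A k-set R ⊇ C meeting A ∪ swap p B in C alone is incompatible with both A and swap p B,
    -- whichever of R and swap p R is present.
    not-both : ∀ {A B} → C ⊆ A → higher p A ≡ false → 0 < f A → C ⊆ B → higher p B ≡ false →
      ¬ (0 < f (swap p B))
    not-both {A} {B} C⊆A hA 0<fA C⊆B hB 0<fσB = [ R-absent , σR-absent ]′ present
      where
      room : (k ∸ ∣ C ∣) + ∣ A ∪ swap p B ∣ ≤ n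
      room = s≤s⁻¹ (begin
        suc (k ∸ ∣ C ∣ + ∣ A ∪ swap p B ∣)   ≤⟨ s≤s (+-monoʳ-≤ (k ∸ ∣ C ∣) (∣∪∣≤ A (swap p B))) ⟩
        suc (k ∸ ∣ C ∣ + (∣ A ∣ + ∣ swap p B ∣)) ≡⟨ cong₂ (λ a b → suc (k ∸ ∣ C ∣ + (a + b))) (size L 0<fA) (size L 0<fσB) ⟩
        -- The core contains the lower point, so it is not empty; this saves the one place by which
        -- `3 * k` may exceed `n`.
        suc (k ∸ ∣ C ∣) + (k + k)            ≤⟨ +-monoˡ-≤ (k + k) (∸-monoʳ-< (lower⇒pos p C lo) c≤k) ⟩
        k + (k + k)                          ≡⟨ cong (λ x → k + (k + x)) (sym (+-identityʳ k)) ⟩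
        3 * k                                ≤⟨ 3k≤1+n ⟩
        suc n                                ∎)
        where open ≤-Reasoning
      extension : ∃[ R ] (∣ R ∣ ≡ k × C ⊆ R × R ∩ (A ∪ swap p B) ≡ C)
      extension = extend-⊇ {k = k} {C} {A ∪ swap p B} (⊆-trans C⊆A (p⊆p∪q (swap p B))) c≤k room
      R = proj₁ extension
      C⊆R : C ⊆ R
      C⊆R = proj₁ (proj₂ (proj₂ extension))
      R∩U⊆C : ∀ {x} → x ∈ R → x ∈ A ∪ swap p B → x ∈ C
      R∩U⊆C {x} x∈R x∈U = subst (x ∈_) (proj₂ (proj₂ (proj₂ extension))) (x∈p∩q⁺ (x∈R , x∈U))
      gR : g R ≡ suc ∣ C ∣
      gR = g-∈ C⊆R (proj₁ (proj₂ extension))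
      present : suc ∣ C ∣ ≤ f R ⊎ suc ∣ C ∣ ≤ f (swap p R)
      present with shift-pair p f R
      ... | inj₁ (e , _) = inj₁ (≤-reflexive (trans (sym gR) e))
      ... | inj₂ (e , _) = inj₂ (≤-reflexive (trans (sym gR) e))
      R-absent : ¬ (suc ∣ C ∣ ≤ f R)
      R-absent le = contradiction (trans (sym (trans (lower-swap p B) hB)) (lower-⊆ p C⊆σB lo)) λ ()
        where
        R∩σB⊆C∩σB : R ∩ swap p B ⊆ C ∩ swap p B
        R∩σB⊆C∩σB x∈ with x∈p∩q⁻ R (swap p B) x∈
        ... | x∈R , x∈σB = x∈p∩q⁺ (R∩U⊆C x∈R (q⊆p∪q A (swap p B) x∈σB) , x∈σB)
        C⊆σB : C ⊆ swap p B
        -- If `R` has level `∣ C ∣`, then `swap p B` must contain all of `C`, yet it lacks the lower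
        -- point.
        C⊆σB = ⊆-of-∣∩∣ C (swap p B) (≤-trans (s≤s⁻¹ (≤-trans le (meet L (≤-trans (s≤s z≤n) le) 0<fσB)))
          (p⊆q⇒∣p∣≤∣q∣ R∩σB⊆C∩σB))
      higher-R : ∀ b → higher p R ≡ b → higher p R ≡ false
      higher-R false e = e
      higher-R true  e = contradiction (trans (sym hi)
        (trans (cong (higher p) (sym (proj₂ (proj₂ (proj₂ extension)))))
        (trans (higher-∩ p R _) (cong₂ _∧_ e (higher-⊆ p (q⊆p∪q A (swap p B))
          (trans (higher-swap p B) (lower-⊆ p C⊆B lo))))))) λ ()
      σR-absent : ¬ (suc ∣ C ∣ ≤ f (swap p R))
      σR-absent le = <-irrefl refl (begin-strict
        ∣ C ∣              ≤⟨ s≤s⁻¹ (≤-trans le (meet L (≤-trans (s≤s z≤n) le) 0<fA)) ⟩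
        ∣ swap p R ∩ A ∣   ≡⟨ cong ∣_∣ (∩-comm (swap p R) A) ⟩
        ∣ A ∩ swap p R ∣   <⟨ ∩-swap-< p A R (lower-⊆ p C⊆A lo) (lower-⊆ p C⊆R lo) hA (higher-R _ refl) ⟩
        ∣ A ∩ R ∣          ≤⟨ p⊆q⇒∣p∣≤∣q∣ A∩R⊆C ⟩
        ∣ C ∣              ∎)
        where
        open ≤-Reasoning
        A∩R⊆C : A ∩ R ⊆ C
        A∩R⊆C x∈ with x∈p∩q⁻ A R x∈
        ... | x∈A , x∈R = R∩U⊆C x∈R (p⊆p∪q (swap p B) x∈A)

    -- If some member of `f` contains `C` and not the higher point, `not-both` excludes every set
    -- that the shift would have moved. If there is none, all members without the higher point come
    -- from their swaps.
    unshift-lowered : (∀ A → f A ≡ g A) ⊎ (∀ A → f A ≡ g (swap p A))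
    unshift-lowered with anySubset? (λ A → (C ⊆? A) ×-dec (higher p A ≟ᵇ false) ×-dec (1 ≤? f A))
    ... | yes (A₀ , C⊆A₀ , hA₀ , 0<fA₀) = inj₁ λ A → unmoved A _ _ refl refl
      where
      stays : ∀ B → lower p B ≡ true → higher p B ≡ false → f (swap p B) ≡ g B → g B ≡ 0
      stays B lB hB e with pos-or-0 (g B)
      ... | inj₂ g≡0 = g≡0
      ... | inj₁ 0<gB = contradiction (subst (0 <_) (sym e) 0<gB) (not-both C⊆A₀ hA₀ 0<fA₀ (proj₁ (g-pos 0<gB)) hB)
      unmoved : ∀ A x y → lower p A ≡ x → higher p A ≡ y → f A ≡ g A
      unmoved A x y lA hA with shift-pair p f A
      unmoved A x     y     lA hA | inj₁ (e , _) = sym e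
      unmoved A true  true  lA hA | inj₂ (e , _) = trans (cong f (sym (swap-fixes p A (trans lA (sym hA))))) (sym e)
      unmoved A false false lA hA | inj₂ (e , _) = trans (cong f (sym (swap-fixes p A (trans lA (sym hA))))) (sym e)
      unmoved A true  false lA hA | inj₂ (e , e′) =
        trans (trans (sym e′) (∌lower⇒0 (trans (lower-swap p A) hA))) (sym (stays A lA hA (sym e)))
      unmoved A false true  lA hA | inj₂ (e , e′) =
        trans (trans (sym e′) (stays (swap p A) (trans (lower-swap p A) hA) (trans (higher-swap p A) lA)
                                (trans (cong f (swap-involutive p A)) (sym e′))))
              (sym (∌lower⇒0 lA))
    ... | no none = inj₂ λ A → moved A _ _ refl refl
      where
      absent : ∀ B → higher p B ≡ false → f B ≡ g B → g B ≡ 0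
      absent B hB e with pos-or-0 (g B)
      ... | inj₂ g≡0 = g≡0
      ... | inj₁ 0<gB = contradiction (B , (λ {x} → proj₁ (g-pos 0<gB) {x}) , hB , subst (0 <_) (sym e) 0<gB) none
      moved : ∀ A x y → lower p A ≡ x → higher p A ≡ y → f A ≡ g (swap p A)
      moved A x y lA hA with shift-pair p f A
      moved A x     y     lA hA | inj₂ (_ , e) = sym e
      moved A true  true  lA hA | inj₁ (e , _) = trans (sym e) (cong g (sym (swap-fixes p A (trans lA (sym hA)))))
      moved A false false lA hA | inj₁ (e , _) = trans (sym e) (cong g (sym (swap-fixes p A (trans lA (sym hA)))))
      moved A true  false lA hA | inj₁ (e , _) =
        trans (trans (sym e) (absent A hA (sym e))) (sym (∌lower⇒0 (trans (lower-swap p A) hA)))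
      moved A false true  lA hA | inj₁ (e , e′) =
        trans (trans (sym e) (∌lower⇒0 lA))
              (sym (absent (swap p A) (trans (higher-swap p A) lA) (sym e′)))

  fullStar-unshift : FullStar k f
  fullStar-unshift = cases _ _ refl refl
    where
    unmoved : (∀ A → f A ≡ g A) → FullStar k f
    unmoved eq = C , c≤k , λ A → trans (eq A) (full A)
    moved : (∀ A → f A ≡ g (swap p A)) → FullStar k f
    moved eq = swap p C , subst (_≤ k) (sym (∣swap∣ p C)) c≤k , λ A → begin
      f A                                        ≡⟨ eq A ⟩
      g (swap p A)                               ≡⟨ full (swap p A) ⟩
      star k C (suc ∣ C ∣) (swap p A)            ≡⟨ sym (star-swap {k = k} p C A) ⟩
      star k (swap p C) (suc ∣ C ∣) A            ≡⟨ cong (λ c → star k (swap p C) (suc c) A) (sym (∣swap∣ p C)) ⟩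
      star k (swap p C) (suc ∣ swap p C ∣) A     ∎
      where open ≡-Reasoning
    cases : ∀ x y → lower p C ≡ x → higher p C ≡ y → FullStar k f
    cases true  true  lo hi = unmoved (unshift-fixed (trans lo (sym hi)))
    cases false false lo hi = unmoved (unshift-fixed (trans lo (sym hi)))
    cases false true  lo hi = unmoved (unshift-raised lo hi)
    cases true  false lo hi = [ unmoved , moved ]′ (unshift-lowered lo hi)

-- The bound and its equality case for arbitrary labellings

module _ {n k : ℕ} (1≤k : 1 ≤ k) (large : threshold k ≤ 2 * n) where
  threshold⇒k<n : k < n
  threshold⇒k<n = *-cancelˡ-≤ 2 (≤-trans (*-mono-≤ (s≤s 1≤k) (≤-refl {suc k})) (≤-trans step large))
    where
    step : suc k * suc k ≤ threshold k
    step = ≤-trans (≤-reflexive (sym (+-identityʳ _))) (*-monoˡ-≤ (suc k * suc k) 1≤k)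

  -- The bound is attained for `k = 1` and `n = 2`, which is why `suc n` stands on the right.
  threshold⇒3k≤1+n : 3 * k ≤ suc n
  threshold⇒3k≤1+n = bound 1≤k large
    where
    identity : ∀ k → suc k * (suc (suc k) * suc (suc k)) + 2 ≡ 2 * (3 * suc k) + (k * k * k + 5 * (k * k) + 2 * k)
    identity = solve-∀
    double : ∀ n → 2 * n + 2 ≡ 2 * suc n
    double = solve-∀
    bound : ∀ {k} → 1 ≤ k → threshold k ≤ 2 * n → 3 * k ≤ suc n
    bound {suc k} _ le = *-cancelˡ-≤ 2 (≤-trans
      (≤-from-+ (2 * (3 * suc k)) (k * k * k + 5 * (k * k) + 2 * k) (identity k))
      (≤-trans (+-monoˡ-≤ 2 le) (≤-reflexive (double n))))

  threshold⇒2k≤n : 2 * k ≤ n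
  threshold⇒2k≤n = s≤s⁻¹ (≤-trans (+-monoˡ-≤ (2 * k) 1≤k) threshold⇒3k≤1+n)

  -- Every weight is at most that of the full star, so equal sums force equality at each set.
  -- Positive and strictly increasing level weights then determine the labels.
  trivial-full : ∀ {f : Subset n → ℕ} → Labelling k f → ∀ C → Trivial f C → totalWeight n k f ≡ fall n k → FullStar k f
  trivial-full {f} L C triv W≡ = C , c≤k , labels
    where
    k<n = threshold⇒k<n
    someone : ∃[ A ] 0 < f A
    someone with anySubset? (λ A → 1 ≤? f A)
    ... | yes p = p
    ... | no ¬p = contradiction
      (trans (sym W≡) (totalWeight-0 {n} {k} (λ A → n≤0⇒n≡0 (≮⇒≥ λ pos → ¬p (A , pos)))))
      (>⇒≢ (fall-pos (<⇒≤ k<n)))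
    c≤k : ∣ C ∣ ≤ k
    c≤k = subst (∣ C ∣ ≤_) (size L (proj₂ someone)) (p⊆q⇒∣p∣≤∣q∣ (proj₁ (triv (proj₂ someone))))
    w = levelWeight n k ∣ C ∣
    w-pos : 0 < w
    w-pos = levelWeight-pos c≤k (<⇒≤ k<n)
    weights : ∀ A → labelWeight n k (f A) ≡ star k C w A
    weights = ∑-≤-≡ (labelWeight≤star L k<n c≤k triv) (trans W≡ (sym (∑-star C c≤k (<⇒≤ k<n))))
    labels : ∀ A → f A ≡ star k C (suc ∣ C ∣) A
    labels A with f A in eq | weights A
    ... | suc j | e with 0<fA ← subst (0 <_) (sym eq) (s≤s (z≤n {j})) with C⊆A , le ← triv 0<fA =
      trans (cong suc (level (m≤n⇒m<n∨m≡n (s≤s⁻¹ (subst (_≤ suc ∣ C ∣) eq le)))))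
            (sym (star-∈ C⊆A (size L 0<fA)))
      where
      level : j < ∣ C ∣ ⊎ j ≡ ∣ C ∣ → j ≡ ∣ C ∣
      level (inj₁ j<c) = contradiction (trans e (star-∈ C⊆A (size L 0<fA))) (<⇒≢ (levelWeight-mono-< j<c c≤k k<n))
      level (inj₂ j≡c) = j≡c
    ... | zero  | e with pos-or-0 (star k C (suc ∣ C ∣) A)
    ...   | inj₂ s≡0 = sym s≡0
    ...   | inj₁ 0<s with C⊆A , ∣A∣≡k , _ ← star-pos {k = k} {C} {A} 0<s =
      contradiction (trans e (star-∈ C⊆A ∣A∣≡k)) (<⇒≢ w-pos)

  -- Since `k ≥ 2`, `slack k` is at most `2 n − 4` and thus below `2 (n − 1)`.
  light-strict : ∀ {f : Subset n → ℕ} → 2 ≤ k → 2 * (n ∸ 1) * totalWeight n k f ≤ slack k * fall n k →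
    totalWeight n k f ≢ fall n k
  light-strict {f} 2≤k le W≡ = <⇒≱ slack< (*-cancelʳ-≤ _ _ (fall n k) {{>-nonZero (fall-pos (<⇒≤ threshold⇒k<n))}}
    (subst (λ w → 2 * (n ∸ 1) * w ≤ slack k * fall n k) W≡ le))
    where
    split : ∀ {k} → 2 ≤ k → threshold k ≤ 2 * n → slack k + 4 ≤ 2 * n
    split {suc k} 2≤k le = ≤-trans (+-monoʳ-≤ (slack (suc k)) (*-monoʳ-≤ 2 2≤k)) (≤-trans (≤-reflexive (sym (threshold≡ k))) le)
    slack< : slack k < 2 * (n ∸ 1)
    slack< = +-cancelʳ-≤ 3 _ _ (begin
      suc (slack k) + 3   ≡⟨ sym (+-suc (slack k) 3) ⟩
      slack k + 4         ≤⟨ split 2≤k large ⟩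
      2 * n               ≡⟨ cong (2 *_) (sym (m+[n∸m]≡n (≤-trans (s≤s z≤n) threshold⇒k<n))) ⟩
      2 * (1 + (n ∸ 1))   ≡⟨ *-distribˡ-+ 2 1 (n ∸ 1) ⟩
      2 + 2 * (n ∸ 1)     ≤⟨ n≤1+n _ ⟩
      3 + 2 * (n ∸ 1)     ≡⟨ +-comm 3 (2 * (n ∸ 1)) ⟩
      2 * (n ∸ 1) + 3     ∎)
      where open ≤-Reasoning

  -- Shifts are applied while they lower the energy. The bound returns because a shift keeps the
  -- total weight, the equality case by `fullStar-unshift`.
  weight-bound : ∀ {f : Subset n → ℕ} → Labelling k f →
    totalWeight n k f ≤ fall n k × (totalWeight n k f ≡ fall n k → FullStar k f)
  weight-bound {f} L = go f L (<-wellFounded (energy f))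
    where
    go : ∀ f → Labelling k f → Acc _<_ (energy f) →
      totalWeight n k f ≤ fall n k × (totalWeight n k f ≡ fall n k → FullStar k f)
    go f L (acc rec) with shifted-or-not f
    ... | inj₁ sh with out ← shifted-outcome n k L sh (λ _ → m≤n⇒m≤n+o _ large) =
      outcome-≤ threshold⇒k<n L out , equality out
      where
      equality : Outcome n k f → totalWeight n k f ≡ fall n k → FullStar k f
      equality (trivial C triv) = trivial-full L C triv
      equality (light 2≤k _ le) W≡ = contradiction W≡ (light-strict {f} 2≤k le)
    ... | inj₂ (p , unshifted)
      with le , eq ← go (shift p f) (shift-labelling p L) (rec (energy-shift p f unshifted)) =
      subst (_≤ fall n k) (∑-shift p (labelWeight n k) f) le , λ W≡ → back (eq (trans (∑-shift p (labelWeight n k) f) W≡))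
      where
      back : FullStar k (shift p f) → FullStar k f
      back (C , c≤k , full) = fullStar-unshift p L threshold⇒2k≤n threshold⇒3k≤1+n {C} c≤k full

-- Families

module _ {n : ℕ} where
  open DecMembership (≡-dec {n = n} _≟ᵇ_) public using () renaming (_∈?_ to _∈ᶠ?_)

minInter-≤ : ∀ {n} {A B : Subset n} {F} → B ∈ᶠ F → minInter A F ≤ ∣ A ∩ B ∣
minInter-≤ {F = B ∷ F} (here refl) = m⊓n≤m _ _
minInter-≤ {A = A} {F = B ∷ F} (there B∈F) = ≤-trans (m⊓n≤n ∣ A ∩ B ∣ _) (minInter-≤ B∈F)

minInter-glb : ∀ {n c} {A : Subset n} F → c ≤ ∣ A ∣ → (∀ {B} → B ∈ᶠ F → c ≤ ∣ A ∩ B ∣) → c ≤ minInter A F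
minInter-glb []      c≤A c≤F = c≤A
minInter-glb (B ∷ F) c≤A c≤F = ⊓-glb (c≤F (here refl)) (minInter-glb F c≤A (c≤F ∘ there))

restrict : ∀ {n} → Family n → (Subset n → ℕ) → Subset n → ℕ
restrict F φ A = if does (A ∈ᶠ? F) then φ A else 0

restrict-∈ : ∀ {n} (F : Family n) (φ : Subset n → ℕ) {A} → A ∈ᶠ F → restrict F φ A ≡ φ A
restrict-∈ F φ {A} A∈F with A ∈ᶠ? F
... | yes _   = refl
... | no A∉F = contradiction A∈F A∉F

restrict-∉ : ∀ {n} (F : Family n) (φ : Subset n → ℕ) {A} → ¬ (A ∈ᶠ F) → restrict F φ A ≡ 0
restrict-∉ F φ {A} A∉F with A ∈ᶠ? F
... | yes A∈F = contradiction A∈F A∉F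
... | no _    = refl

label : ∀ {n} → Family n → Subset n → ℕ
label F = restrict F (suc ∘ iF F)

label-∈ : ∀ {n} {F : Family n} {A} → A ∈ᶠ F → label F A ≡ suc (iF F A)
label-∈ {F = F} = restrict-∈ F (suc ∘ iF F)

label-pos : ∀ {n} {F : Family n} {A} → 0 < label F A → A ∈ᶠ F
label-pos {F = F} {A} pos with A ∈ᶠ? F
... | yes A∈F = A∈F

label-labelling : ∀ {n k} {F : Family n} → AllOfSize k F → Labelling k (label F)
label-labelling {F = F} sizes = record
  { size = λ {A} pos → sizes A (label-pos {F = F} pos)
  ; meet = λ {A} {B} a b → ≤-trans (≤-reflexive (label-∈ (label-pos {F = F} {A} a)))
                                   (s≤s (minInter-≤ (label-pos {F = F} {B} b)))
  }

∑-single : ∀ {n} (B : Subset n) (φ : Subset n → ℕ) → (∀ A → A ≢ B → φ A ≡ 0) → ∑ φ ≡ φ B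
∑-single []          φ zero-off = refl
∑-single {suc n} (false ∷ B) φ zero-off = trans
  (cong₂ _+_ (∑-single B (φ ∘ (outside ∷_)) (λ A A≢B → zero-off _ λ { refl → A≢B refl }))
             (trans (∑-cong (λ A → zero-off (inside ∷ A) λ ())) (∑-0 n)))
  (+-identityʳ _)
∑-single {suc n} (true  ∷ B) φ zero-off = cong₂ _+_
  (trans (∑-cong (λ A → zero-off (outside ∷ A) λ ())) (∑-0 n))
  (∑-single B (φ ∘ (inside ∷_)) (λ A A≢B → zero-off _ λ { refl → A≢B refl }))

sumOver : ∀ {n} → (Subset n → ℕ) → Family n → ℕ
sumOver φ = foldr (λ A acc → φ A + acc) 0

-- Uniqueness makes the indicators of the head and of the tail disjoint, so their contributions add.
sumOver≡∑ : ∀ {n} (φ : Subset n → ℕ) {F : Family n} → Unique F → sumOver φ F ≡ ∑ (restrict F φ)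
sumOver≡∑ {n} φ {[]}    []            = sym (∑-0 n)
sumOver≡∑ {n} φ {B ∷ F} (B∉ ∷ unique) = sym (begin
  ∑ (restrict (B ∷ F) φ)                         ≡⟨ ∑-cong split ⟩
  ∑ (λ A → single A + restrict F φ A)            ≡⟨ ∑-+ single (restrict F φ) ⟩
  ∑ single + ∑ (restrict F φ)                    ≡⟨ cong₂ _+_ (∑-single B single off) (sym (sumOver≡∑ φ unique)) ⟩
  single B + sumOver φ F                         ≡⟨ cong (_+ sumOver φ F) (restrict-∈ (B ∷ []) φ (here refl)) ⟩
  φ B + sumOver φ F                              ∎)
  where
  open ≡-Reasoning
  single : Subset n → ℕ
  single = restrict (B ∷ []) φ
  off : ∀ A → A ≢ B → single A ≡ 0
  off A A≢B = restrict-∉ (B ∷ []) φ λ { (here A≡B) → A≢B A≡B }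
  split′ : ∀ {A} → Dec (A ≡ B) → Dec (A ∈ᶠ F) → restrict (B ∷ F) φ A ≡ single A + restrict F φ A
  split′ (yes refl) _ = trans (restrict-∈ (B ∷ F) φ (here refl)) (sym (trans
    (cong₂ _+_ (restrict-∈ (B ∷ []) φ (here refl)) (restrict-∉ F φ (All¬⇒¬Any B∉)))
    (+-identityʳ (φ B))))
  split′ (no A≢B) (yes A∈F) = trans (restrict-∈ (B ∷ F) φ (there A∈F))
    (sym (cong₂ _+_ (off _ A≢B) (restrict-∈ F φ A∈F)))
  split′ (no A≢B) (no A∉F) = trans
    (restrict-∉ (B ∷ F) φ λ { (here A≡B) → A≢B A≡B ; (there A∈F) → A∉F A∈F })
    (sym (cong₂ _+_ (off _ A≢B) (restrict-∉ F φ A∉F)))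
  split : ∀ A → restrict (B ∷ F) φ A ≡ single A + restrict F φ A
  split A = split′ (≡-dec _≟ᵇ_ A B) (A ∈ᶠ? F)

-- Fractions with a common denominator

infixl 7 _//_
_//_ : ℕ → (d : ℕ) → .{{NonZero d}} → ℚ
a // d = ℤ.+ a /ℚ d

//-cong : ∀ {a b c d} .{{_ : NonZero b}} .{{_ : NonZero d}} → a * d ≡ c * b → a // b ≡ c // d
//-cong {a} {suc b} {c} {suc d} eq = ℚ.fromℚᵘ-cong {mkℚᵘ (ℤ.+ a) b} {mkℚᵘ (ℤ.+ c) d}
  (*≡* (trans (sym (ℤ.pos-* a (suc d))) (trans (cong ℤ.+_ eq) (ℤ.pos-* c (suc b)))))

//-+ : ∀ a b d .{{_ : NonZero d}} → a // d +ℚ b // d ≡ (a + b) // d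
//-+ a b (suc d) = ℚ.toℚᵘ-injective (begin
  toℚᵘ (a // suc d +ℚ b // suc d)                      ≈⟨ ℚ.toℚᵘ-homo-+ (a // suc d) (b // suc d) ⟩
  toℚᵘ (a // suc d) ℚᵘ.+ toℚᵘ (b // suc d)             ≈⟨ ℚᵘ.+-cong (ℚ.toℚᵘ-fromℚᵘ (mkℚᵘ (ℤ.+ a) d)) (ℚ.toℚᵘ-fromℚᵘ (mkℚᵘ (ℤ.+ b) d)) ⟩
  mkℚᵘ (ℤ.+ a) d ℚᵘ.+ mkℚᵘ (ℤ.+ b) d                   ≈⟨ *≡* (cong (ℤ._* ℤ.+ suc d) (sym (ℤ.*-distribʳ-+ (ℤ.+ suc d) (ℤ.+ a) (ℤ.+ b))) ⟨ trans ⟩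
                                                             ℤ.*-assoc (ℤ.+ (a + b)) (ℤ.+ suc d) (ℤ.+ suc d)) ⟩
  mkℚᵘ (ℤ.+ (a + b)) d                                 ≈⟨ ℚᵘ.≃-sym (ℚ.toℚᵘ-fromℚᵘ (mkℚᵘ (ℤ.+ (a + b)) d)) ⟩
  toℚᵘ ((a + b) // suc d)                              ∎)
  where
  open ℚᵘ.≃-Reasoning

//-≤1 : ∀ {a d} .{{_ : NonZero d}} → a ≤ d → a // d ≤ℚ 1ℚ
//-≤1 {a} {suc d} le = ℚ.toℚᵘ-cancel-≤ (ℚᵘ.≤-respˡ-≃ (ℚᵘ.≃-sym (ℚ.toℚᵘ-fromℚᵘ (mkℚᵘ (ℤ.+ a) d)))
  (*≤* (subst₂ ℤ._≤_ (sym (ℤ.*-identityʳ (ℤ.+ a))) (sym (ℤ.*-identityˡ (ℤ.+ suc d))) (ℤ.+≤+ le))))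

//≡1⁻ : ∀ {a d} .{{_ : NonZero d}} → a // d ≡ 1ℚ → a ≡ d
//≡1⁻ {a} {suc d} eq with *≡* e ← ℚ.fromℚᵘ-injective {mkℚᵘ (ℤ.+ a) d} {ℚᵘ.1ℚᵘ} eq =
  ℤ.+-injective (trans (sym (ℤ.*-identityʳ (ℤ.+ a))) (trans e (ℤ.*-identityˡ (ℤ.+ suc d))))

//≡1 : ∀ d .{{_ : NonZero d}} → d // d ≡ 1ℚ
//≡1 d = //-cong {d} {d} {1} {1} (*-comm d 1)

recip≡// : ∀ {c w d} .{{_ : NonZero d}} → c * w ≡ d → recip c ≡ w // d
recip≡// {suc c} {w} {d} eq = //-cong {1} {suc c} {w} {d} (trans (+-identityʳ d) (trans (sym eq) (*-comm (suc c) w)))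
-- The default value of `recip` at 0 is never met, since the product `d` is nonzero.
recip≡// {zero}  {w} {suc d} ()

module _ {n k : ℕ} (k≤n : k ≤ n) {F : Family n} (sizes : AllOfSize k F) where
  private instance
    fall≢0 : NonZero (fall n k)
    fall≢0 = >-nonZero (fall-pos k≤n)

  iF≤k : ∀ {A} → A ∈ᶠ F → iF F A ≤ k
  iF≤k {A} A∈F = ≤-trans (minInter-≤ A∈F) (≤-trans (∣p∩q∣≤∣p∣ A A) (≤-reflexive (sizes A A∈F)))

  Φ≡sum : Φ n k F ≡ sumOver (λ A → levelWeight n k (iF F A)) F // fall n k
  Φ≡sum = go F (λ A∈F → A∈F)
    where
    -- The induction runs over a part `G` of the list while the levels remain those of `F`.
    go : ∀ G → (∀ {A} → A ∈ᶠ G → A ∈ᶠ F) →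
      foldr (λ A acc → recip ((n ∸ iF F A) choose (k ∸ iF F A)) +ℚ acc) 0ℚ G ≡
      sumOver (λ A → levelWeight n k (iF F A)) G // fall n k
    go []      G⊆F = //-cong {0} {1} {0} {fall n k} refl
    go (A ∷ G) G⊆F = trans
      (cong₂ _+ℚ_ (recip≡// {(n ∸ iF F A) choose (k ∸ iF F A)} {levelWeight n k (iF F A)} (C*levelWeight≡fall n k (iF F A) (iF≤k (G⊆F (here refl))) k≤n)) (go G (G⊆F ∘ there)))
      (//-+ (levelWeight n k (iF F A)) (sumOver (λ A → levelWeight n k (iF F A)) G) (fall n k))

  Φ≡totalWeight : Unique F → Φ n k F ≡ totalWeight n k (label F) // fall n k
  Φ≡totalWeight unique = trans Φ≡sum (cong (_// fall n k)
    (trans (sumOver≡∑ (λ A → levelWeight n k (iF F A)) unique) (∑-cong pointwise)))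
    where
    pointwise : ∀ A → restrict F (λ A → levelWeight n k (iF F A)) A ≡ labelWeight n k (label F A)
    pointwise A with does (A ∈ᶠ? F)
    ... | true  = refl
    ... | false = refl

  Φ≤1 : Unique F → totalWeight n k (label F) ≤ fall n k → Φ n k F ≤ℚ 1ℚ
  Φ≤1 unique le = subst (_≤ℚ 1ℚ) (sym (Φ≡totalWeight unique)) (//-≤1 le)

  Φ≡1⇔ : Unique F → Φ n k F ≡ 1ℚ ⇔ totalWeight n k (label F) ≡ fall n k
  Φ≡1⇔ unique = mk⇔
    (λ eq → //≡1⁻ (trans (sym (Φ≡totalWeight unique)) eq))
    (λ eq → trans (Φ≡totalWeight unique) (trans (cong (_// fall n k) eq) (//≡1 (fall n k))))

  fullStar⇒isStar : FullStar k (label F) → Σ ℕ λ c → c ≤ k × IsStar k c F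
  fullStar⇒isStar (C , c≤k , full) = ∣ C ∣ , c≤k , C , refl , λ A → mk⇔ member⇒⊇ ⊇⇒member
    where
    member⇒⊇ : ∀ {A} → A ∈ᶠ F → ∣ A ∣ ≡ k × C ⊆ A
    member⇒⊇ {A} A∈F = sizes A A∈F ,
      proj₁ (star-pos {k = k} {C} {A} (subst (0 <_) (trans (sym (label-∈ A∈F)) (full A)) (s≤s z≤n)))
    ⊇⇒member : ∀ {A} → ∣ A ∣ ≡ k × C ⊆ A → A ∈ᶠ F
    ⊇⇒member {A} (∣A∣≡k , C⊆A) = label-pos {F = F} (subst (0 <_) (sym (trans (full A) (star-∈ {C = C} {A} C⊆A ∣A∣≡k))) (s≤s z≤n))

  -- Every level equals the core size: all members share `C`, and `2 * k ≤ n` leaves room for a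
  -- member that meets a given one in `C` only.
  isStar⇒weight : 2 * k ≤ n → ∀ {c} → c ≤ k → IsStar k c F → totalWeight n k (label F) ≡ fall n k
  isStar⇒weight 2k≤n {c} c≤k (C , refl , star⇔) = trans (∑-cong weights) (∑-star C c≤k k≤n)
    where
    core≤ : ∀ {A} → A ∈ᶠ F → ∣ C ∣ ≤ iF F A
    core≤ {A} A∈F = minInter-glb F (p⊆q⇒∣p∣≤∣q∣ (C⊆ A∈F)) λ B∈F →
      p⊆q⇒∣p∣≤∣q∣ (λ x∈C → x∈p∩q⁺ (C⊆ A∈F x∈C , C⊆ B∈F x∈C))
      where
      C⊆ : ∀ {B} → B ∈ᶠ F → C ⊆ B
      C⊆ B∈F = proj₂ (Equivalence.to (star⇔ _) B∈F)
    core≥ : ∀ {A} → A ∈ᶠ F → iF F A ≤ ∣ C ∣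
    core≥ {A} A∈F = bound (extend-⊇ {k = k} {C} {A} C⊆A c≤k room)
      where
      C⊆A : C ⊆ A
      C⊆A = proj₂ (Equivalence.to (star⇔ A) A∈F)
      room : (k ∸ ∣ C ∣) + ∣ A ∣ ≤ n
      room = ≤-trans (+-mono-≤ (m∸n≤m k ∣ C ∣) (≤-reflexive (trans (sizes A A∈F) (sym (+-identityʳ k))))) 2k≤n
      bound : ∃[ R ] (∣ R ∣ ≡ k × C ⊆ R × R ∩ A ≡ C) → iF F A ≤ ∣ C ∣
      bound (R , ∣R∣≡k , C⊆R , eq) = ≤-trans (minInter-≤ (Equivalence.from (star⇔ R) (∣R∣≡k , C⊆R)))
        (≤-reflexive (cong ∣_∣ (trans (∩-comm A R) eq)))
    weights : ∀ A → labelWeight n k (label F A) ≡ star k C (levelWeight n k ∣ C ∣) A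
    weights A with pos-or-0 (label F A)
    ... | inj₁ pos with A∈F ← label-pos {F = F} {A} pos = trans
      (cong (labelWeight n k) (trans (label-∈ A∈F) (cong suc (≤-antisym (core≥ A∈F) (core≤ A∈F)))))
      (sym (star-∈ {C = C} {A} (proj₂ (Equivalence.to (star⇔ A) A∈F)) (sizes A A∈F)))
    ... | inj₂ l≡0 with pos-or-0 (star k C (levelWeight n k ∣ C ∣) A)
    ...   | inj₂ s≡0 = trans (cong (labelWeight n k) l≡0) (sym s≡0)
    ...   | inj₁ 0<s with C⊆A , ∣A∣≡k , _ ← star-pos {k = k} {C} {A} 0<s =
      contradiction (trans (sym l≡0) (label-∈ (Equivalence.from (star⇔ A) (∣A∣≡k , C⊆A)))) λ ()

theorem1p1 : (n k : ℕ) → 1 ≤ k → k ^ 3 + 2 * k ^ 2 + k ≤ 2 * n →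
    (F : Family n) → Unique F → AllOfSize k F →
    (Φ n k F ≤ℚ 1ℚ) × (Φ n k F ≡ 1ℚ ⇔ Σ ℕ λ c → c ≤ k × IsStar k c F)
theorem1p1 n k 1≤k bound F unique sizes = Φ≤1 k≤n sizes unique (proj₁ weight) , mk⇔
  (λ Φ≡1 → fullStar⇒isStar k≤n sizes (proj₂ weight (Equivalence.to (Φ≡1⇔ k≤n sizes unique) Φ≡1)))
  (λ { (c , c≤k , isStar) → Equivalence.from (Φ≡1⇔ k≤n sizes unique)
         (isStar⇒weight k≤n sizes (threshold⇒2k≤n 1≤k large) c≤k isStar) })
  where
  -- The powers are written in the form to which `k ^ 3` and `k ^ 2` reduce.
  cubic : ∀ k → k * (suc k * suc k) ≡ k * (k * (k * 1)) + 2 * (k * (k * 1)) + k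
  cubic = solve-∀
  large : threshold k ≤ 2 * n
  large = ≤-trans (≤-reflexive (cubic k)) bound
  k≤n : k ≤ n
  k≤n = <⇒≤ (threshold⇒k<n 1≤k large)
  weight : totalWeight n k (label F) ≤ fall n k × (totalWeight n k (label F) ≡ fall n k → FullStar k (label F))
  weight = weight-bound 1≤k large (label-labelling sizes)
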